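{- Let $n\ge 2$ be even and $z\in\tilde I^{\mathsf{FPF}}_n$. Let $\prec$ be the transitive relation on $\tilde S_n$ generated by $u\prec_0 v$, where $u\prec_0 v$ means: there exist $m\in\mathbb Z$ and integers $a<b<c<d$ such that $(u^{ -1}(m+1),u^{ -1}(m+2),u^{ -1}(m+3),u^{ -1}(m+4))=(a,d,b,c)$, $(v^{ -1}(m+1),v^{ -1}(m+2),v^{ -1}(m+3),v^{ -1}(m+4))=(b,c,a,d)$, and $u^{ -1}(k)=v^{ -1}(k)$ for all $k\in\{m+5,\dots,m+n\}$ (i.e. $u^{ -1}=[\cdots,a,d,b,c,\cdots]$ and $v^{ -1}=[\cdots,b,c,a,d,\cdots]$ with the windows otherwise identical). Then $\mathcal A^{\mathsf{FPF}}(z)$ is a bounded poset under $\prec$, with unique minimum $\alpha^{\mathsf{FPF}}_{\min}(z)$ and unique maximum $\alpha^{\mathsf{FPF}}_{\max}(z)$.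
   Context: $\tilde S_n$ is the group of bijections $\pi:\mathbb Z\to\mathbb Z$ with $\pi(i+n)=\pi(i)+n$ and $\sum_{i=1}^n\pi(i)=\sum_{i=1}^n i$, a Coxeter group with generators $s_1,\dots,s_n$ ($s_i$ swaps $i+kn,i+1+kn$ for all $k$) and length $\ell$. $\tilde I^{\mathsf{FPF}}_n$ is the set of $z\in\tilde S_n$ with $z(z(i))=i\ne z(i)$ for all $i$. With $\Theta^+=s_1s_3\cdots s_{n-1}$, $\Theta^-=s_2s_4\cdots s_n$, each $z$ is conjugate to exactly one $\Theta\in\{\Theta^\pm\}$; $\mathcal A^{\mathsf{FPF}}(z)$ is the set of minimal-length $w$ with $w^{ -1}\Theta w=z$. Window notation: for integers $c_1,\dots,c_n$ representing each residue mod $n$ once, $[c_1,\dots,c_n]$ is the unique $\pi\in\tilde S_n$ with $\pi(m+k)=c_k$ ($k=1,\dots,n$) for some $m\in\mathbb Z$. With $l=n/2$: $a_1<\dots<a_l$ are the $a\in\{1,\dots,n\}$ with $a<z(a)$, $b_i=z(a_i)$; $d_1<\dots<d_l$ are the $d\in\{1,\dots,n\}$ with $z(d)<d$, $c_i=z(d_i)$; $\alpha^{\mathsf{FPF}}_{\min}(z)=[a_1,b_1,\dots,a_l,b_l]^{ -1}$, $\alpha^{\mathsf{FPF}}_{\max}(z)=[c_1,d_1,\dots,c_l,d_l]^{ -1}$. -}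

module Defs where

open import Data.Nat as ℕ using (ℕ; zero; suc)
import Data.Nat.Divisibility as ℕD
open import Data.Integer as ℤ using (ℤ; +_; _+_; _-_; _<_; ∣_∣)
open import Data.Integer.Properties using (_≟_; _<?_)
open import Data.Fin using (Fin; toℕ)
open import Data.List using (List; []; _∷_; map; filter; concatMap; length; foldr; upTo)
open import Data.Product using (Σ; ∃; ∃-syntax; _×_; _,_)
open import Data.Sum using (_⊎_)
open import Relation.Nullary using (¬_; yes; no)
open import Relation.Binary.PropositionalEquality using (_≡_)
open import Relation.Binary.Construct.Closure.Transitive using (TransClosure)

range1 : ℕ → List ℤ
range1 n = map (λ k → + suc k) (upTo n)

sumℤ : List ℤ → ℤ
sumℤ = foldr _+_ (+ 0)

record AffPerm (n : ℕ) : Set where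
  field
    fun      : ℤ → ℤ
    inv      : ℤ → ℤ
    inv-fun  : ∀ i → inv (fun i) ≡ i
    fun-inv  : ∀ i → fun (inv i) ≡ i
    periodic : ∀ i → fun (i + + n) ≡ fun i + + n
    sumCond  : sumℤ (map fun (range1 n)) ≡ sumℤ (range1 n)

open AffPerm public

_≈_ : ∀ {n} → AffPerm n → AffPerm n → Set
u ≈ v = ∀ i → fun u i ≡ fun v i

sameRes : ℕ → ℤ → ℤ → Set
sameRes n i j = n ℕD.∣ ∣ j - i ∣

s : (n : ℕ) → ℤ → ℤ → ℤ
s n i j with n ℕD.∣? ∣ j - i ∣
... | yes _ = j + + 1
... | no _ with n ℕD.∣? ∣ j - (i + + 1) ∣
...   | yes _ = j - + 1
...   | no _ = j

evalWord : (n : ℕ) → List ℕ → ℤ → ℤ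
evalWord n [] j = j
evalWord n (i ∷ w) j = s n (+ i) (evalWord n w j)

genIndex : ∀ {n} → Fin n → ℕ
genIndex k = suc (toℕ k)

IsLength : ∀ {n} → AffPerm n → ℕ → Set
IsLength {n} w k =
  (Σ (List (Fin n)) λ ws → length ws ≡ k × (∀ j → evalWord n (map genIndex ws) j ≡ fun w j))
  × (∀ (ws : List (Fin n)) → (∀ j → evalWord n (map genIndex ws) j ≡ fun w j) → k ℕ.≤ length ws)

IsFPFInvolution : ∀ {n} → AffPerm n → Set
IsFPFInvolution z = ∀ i → fun z (fun z i) ≡ i × ¬ (fun z i ≡ i)

Θ⁺ : ℕ → ℤ → ℤ
Θ⁺ n = evalWord n (map (λ j → suc (2 ℕ.* j)) (upTo (n ℕ./ 2)))

Θ⁻ : ℕ → ℤ → ℤ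
Θ⁻ n = evalWord n (map (λ j → 2 ℕ.+ 2 ℕ.* j) (upTo (n ℕ./ 2)))

ConjBy : ∀ {n} → (ℤ → ℤ) → AffPerm n → AffPerm n → Set
ConjBy Θ w z = ∀ i → inv w (Θ (fun w i)) ≡ fun z i

ConjTo : ∀ {n} → (ℤ → ℤ) → AffPerm n → Set
ConjTo {n} Θ z = Σ (AffPerm n) λ w → ConjBy Θ w z

-- membership in A^FPF(z): w is of minimal length among all w' with
-- w'⁻¹ Θ w' = z, where Θ ∈ {Θ⁺, Θ⁻} is the one conjugate to z
InAtoms : ∀ {n} → AffPerm n → AffPerm n → Set
InAtoms {n} z w =
  Σ (ℤ → ℤ) λ Θ → (Θ ≡ Θ⁺ n ⊎ Θ ≡ Θ⁻ n) × ConjBy Θ w z ×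
    (Σ ℕ λ k → IsLength w k ×
       (∀ (w' : AffPerm n) → ConjBy Θ w' z → ∀ k' → IsLength w' k' → k ℕ.≤ k'))

window : (ℤ → ℤ) → ℤ → ℕ → List ℤ
window π m n = map (λ k → π (m + k)) (range1 n)

HasWindow : ∀ {n} → (ℤ → ℤ) → List ℤ → Set
HasWindow {n} π cs = Σ ℤ λ m → window π m n ≡ cs

minWindow : ∀ {n} → AffPerm n → List ℤ
minWindow {n} z =
  concatMap (λ a → a ∷ fun z a ∷ []) (filter (λ a → a <? fun z a) (range1 n))

maxWindow : ∀ {n} → AffPerm n → List ℤ
maxWindow {n} z =
  concatMap (λ d → fun z d ∷ d ∷ []) (filter (λ d → fun z d <? d) (range1 n))

IsAlphaMin : ∀ {n} → AffPerm n → AffPerm n → Set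
IsAlphaMin {n} z w = HasWindow {n} (inv w) (minWindow z)

IsAlphaMax : ∀ {n} → AffPerm n → AffPerm n → Set
IsAlphaMax {n} z w = HasWindow {n} (inv w) (maxWindow z)

_≺₀_ : ∀ {n} → AffPerm n → AffPerm n → Set
_≺₀_ {n} u v = Σ ℤ λ m → Σ ℤ λ a → Σ ℤ λ b → Σ ℤ λ c → Σ ℤ λ d →
  a < b × b < c × c < d ×
  (inv u (m + + 1) ≡ a × inv u (m + + 2) ≡ d × inv u (m + + 3) ≡ b × inv u (m + + 4) ≡ c) ×
  (inv v (m + + 1) ≡ b × inv v (m + + 2) ≡ c × inv v (m + + 3) ≡ a × inv v (m + + 4) ≡ d) ×
  (∀ (j : ℕ) → 5 ℕ.≤ j → j ℕ.≤ n → inv u (m + + j) ≡ inv v (m + + j))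

_≺_ : ∀ {n} → AffPerm n → AffPerm n → Set
_≺_ = TransClosure _≺₀_

{-# OPTIONS --safe #-}
module Submission where

-- Read w through its inverse, as a sequence of values at integer positions.  The equation
-- w⁻¹ Θ w = z says that the positions are grouped into adjacent pairs (left e j, left e j + 1)
-- carrying the cycles (p, q) of z, where e = -1 for Θ⁺ and e = 0 for Θ⁻.  With Shi's inversion
-- formula for the length, exchanging two adjacent pairs (p, q), (p′, q′) with p < q and p′ < q′
-- that are out of order shortens w when p > p′ and q > q′, and preserves the length when one cycle
-- is nested in the other; the latter moves are exactly ≺₀.  Bubble sort by p (by q) therefore
-- never leaves the set of atoms and moves down (up) along ≺; it terminates because
-- Σ (p_j - 2j)² over a period drops.  An arrangement with sorted keys is unique, since two of them
-- differ by an increasing affine permutation, which is the identity.  The same sum of squares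
-- strictly increases along ≺₀, whence irreflexivity.


open import Defs
open import Data.Nat as ℕ using (ℕ; zero; suc)
import Data.Nat.Properties as ℕ
import Data.Nat.Divisibility as ℕD
open import Data.Nat.DivMod using (m*n/n≡m)
open import Data.Integer using (ℤ; +_; -[1+_]; 0ℤ; 1ℤ; _+_; _-_; -_; _*_; ∣_∣; _≤_; _<_; +≤+; -≤+)
open import Data.Integer.Properties as ℤ using (_≟_; _<?_; drop‿+≤+; drop‿+<+)
open import Data.Integer.DivMod using (_/ℕ_; _%ℕ_; a≡a%ℕn+[a/ℕn]*n; n%ℕd<d; 0≤n⇒0≤n/ℕd)
import Data.Integer.Divisibility.Signed as ℤD
open import Data.Integer.Tactic.RingSolver using (solve; solve-∀)
import Algebra.Properties.AbelianGroup ℤ.+-0-abelianGroup as ℤ+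
import Algebra.Properties.CommutativeMonoid.Sum as FinSum
open import Data.Fin using (Fin; toℕ; fromℕ<)
import Data.Fin.Properties as Fin
open import Data.Fin.Permutation using (Permutation; permutation)
open import Data.List using (List; []; _∷_; _++_; map; length; upTo; applyUpTo; filter; concatMap)
open import Data.List.Properties using (map-id)
open import Data.Product using (Σ; ∃; _×_; _,_; proj₁; proj₂)
open import Data.Sum using (_⊎_; inj₁; inj₂; [_,_]′)
open import Relation.Nullary using (¬_; Dec; yes; no; contradiction)
open import Relation.Binary.Construct.Closure.Transitive using () renaming ([_] to [_]⁺; _∷_ to _∷⁺_; _++_ to _++⁺_)
open import Relation.Binary.PropositionalEquality


-- The extremal arrangements must be constructed, so some w with w⁻¹ Θ w = z is needed to begin
-- with. It comes from reducing z itself: conjugating by s_i at a descent of z with z i ≠ i + 1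
-- lowers Σ (z i - i)², and a z without such descents is already Θ⁺ or Θ⁻. Pairs stored in falling
-- order are then turned around, each turn being a descent of the inverse and hence shortening w;
-- only after that does sorting begin.
--
-- The offset e stays a variable throughout. Uniqueness of the sorted arrangement is proved for two
-- possibly different offsets, so one extremal element serves every atom of z.
--
-- The slope 2 in Σ (p_j - 2j)² is forced: with n = 2l the keys satisfy p_{j+l} = p_j + 2l, so the
-- summand is periodic and the sum does not depend on the window. Exchanging neighbours changes it
-- by exactly 4 (p_j - p_{j+1}).
--
-- The length of the statement is a minimum over words. It is matched once with an inversion count,
-- after which every length comparison reduces to comparing two values at adjacent positions.

+-congˡ : ∀ x {y z} → y ≡ z → x + y ≡ x + z
+-congˡ x = cong (λ y → x + y)

-- Order goals are reduced to ring identities: the difference is written as an expression that is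
-- visibly nonnegative, usually assembled from `gap` and `gap<`, and the identity is left to the
-- solver.
≤-from : ∀ {x y} d → 0ℤ ≤ d → y ≡ x + d → x ≤ y
≤-from {x} d 0≤d refl = subst (_≤ x + d) (ℤ.+-identityʳ x) (ℤ.+-monoʳ-≤ x 0≤d)

<-from : ∀ {x y} d → 0ℤ ≤ d → y ≡ x + 1ℤ + d → x < y
<-from {x} d 0≤d eq = ℤ.suc[i]≤j⇒i<j (≤-from d 0≤d (trans eq (lem x d)))
  where
  lem : ∀ x d → x + 1ℤ + d ≡ 1ℤ + x + d
  lem = solve-∀

gap : ∀ {x y} → x ≤ y → 0ℤ ≤ y - x
gap = ℤ.i≤j⇒0≤j-i

gap< : ∀ {x y} → x < y → 0ℤ ≤ y - x - 1ℤ
gap< {x} {y} x<y = subst (0ℤ ≤_) (lem x y) (gap (ℤ.i<j⇒suc[i]≤j x<y))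
  where
  lem : ∀ x y → y - (1ℤ + x) ≡ y - x - 1ℤ
  lem = solve-∀

+-nonneg : ∀ {x y} → 0ℤ ≤ x → 0ℤ ≤ y → 0ℤ ≤ x + y
+-nonneg = ℤ.+-mono-≤

*-nonneg : ∀ {x y} → 0ℤ ≤ x → 0ℤ ≤ y → 0ℤ ≤ x * y
*-nonneg {+ m} {+ k} _ _ = subst (0ℤ ≤_) (ℤ.pos-* m k) (+≤+ ℕ.z≤n)

<-or-≥ : ∀ x y → x < y ⊎ y ≤ x
<-or-≥ x y with x <? y
... | yes p = inj₁ p
... | no p = inj₂ (ℤ.≮⇒≥ p)

≢⇒<⊎> : ∀ {x y : ℤ} → x ≢ y → x < y ⊎ y < x
≢⇒<⊎> {x} {y} ne with <-or-≥ x y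
... | inj₁ p = inj₁ p
... | inj₂ p = inj₂ (ℤ.≤∧≢⇒< p (λ q → ne (sym q)))

<suc⇒≤ : ∀ {x y} → x < y + 1ℤ → x ≤ y
<suc⇒≤ {x} {y} p = ≤-from _ (gap< p) (solve (x ∷ y ∷ []))

≤⇒<suc : ∀ {x y} → x ≤ y → x < y + 1ℤ
≤⇒<suc {x} {y} p = <-from _ (gap p) (solve (x ∷ y ∷ []))

<⇒suc≤ : ∀ {x y} → x < y → x + 1ℤ ≤ y
<⇒suc≤ {x} {y} p = ≤-from _ (gap< p) (solve (x ∷ y ∷ []))

i≢i+1 : ∀ i → i ≢ i + 1ℤ
i≢i+1 i = ℤ.<⇒≢ (≤⇒<suc ℤ.≤-refl)

∣∣-mono : ∀ {x y} → 0ℤ ≤ x → x < y → ∣ x ∣ ℕ.< ∣ y ∣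
∣∣-mono {+ a} {+ b} _ p = drop‿+<+ p

+suc : ∀ r → + suc r ≡ + r + 1ℤ
+suc r = trans (cong +_ (ℕ.+-comm 1 r)) (ℤ.pos-+ r 1)

+-suc-assoc : ∀ x r → x + + suc r ≡ x + 1ℤ + + r
+-suc-assoc x r = trans (+-congˡ x (+suc r)) (assoc x (+ r))
  where
  assoc : ∀ x y → x + (y + 1ℤ) ≡ x + 1ℤ + y
  assoc = solve-∀

ℤ-ind : (P : ℤ → Set) → P 0ℤ → (∀ x → P x → P (x + 1ℤ)) → (∀ x → P (x + 1ℤ) → P x) → ∀ x → P x
ℤ-ind P p0 up down (+ zero) = p0
ℤ-ind P p0 up down (+ suc k) = subst P (sym (+suc k)) (up (+ k) (ℤ-ind P p0 up down (+ k)))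
ℤ-ind P p0 up down -[1+ zero ] = down -[1+ 0 ] p0
ℤ-ind P p0 up down -[1+ suc k ] = down -[1+ suc k ] (ℤ-ind P p0 up down -[1+ k ])

-- Sums over intervals of integers

∑ : (ℤ → ℤ) → ℤ → ℕ → ℤ
∑ f x zero = 0ℤ
∑ f x (suc k) = f x + ∑ f (x + 1ℤ) k

∑-cong : ∀ {f g} x k → (∀ r → r ℕ.< k → f (x + + r) ≡ g (x + + r)) → ∑ f x k ≡ ∑ g x k
∑-cong x zero h = refl
∑-cong {f} {g} x (suc k) h = cong₂ _+_
  (subst (λ y → f y ≡ g y) (ℤ.+-identityʳ x) (h 0 (ℕ.s≤s ℕ.z≤n)))
  (∑-cong (x + 1ℤ) k λ r r<k → subst (λ y → f y ≡ g y) (+-suc-assoc x r) (h (suc r) (ℕ.s≤s r<k)))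

∑-cong-all : ∀ {f g} x k → (∀ i → f i ≡ g i) → ∑ f x k ≡ ∑ g x k
∑-cong-all x k h = ∑-cong x k λ r _ → h _

∑-last : ∀ f x k → ∑ f x (suc k) ≡ ∑ f x k + f (x + + k)
∑-last f x zero = trans (ℤ.+-comm (f x) 0ℤ) (+-congˡ 0ℤ (cong f (sym (ℤ.+-identityʳ x))))
∑-last f x (suc k) = trans (+-congˡ (f x) (∑-last f (x + 1ℤ) k))
  (trans (sym (ℤ.+-assoc (f x) _ _)) (cong (λ y → ∑ f x (suc k) + f y) (sym (+-suc-assoc x k))))

∑-+ : ∀ f g x k → ∑ (λ i → f i + g i) x k ≡ ∑ f x k + ∑ g x k
∑-+ f g x zero = refl
∑-+ f g x (suc k) = trans (+-congˡ (f x + g x) (∑-+ f g (x + 1ℤ) k)) (lem (f x) (g x) _ _)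
  where
  lem : ∀ a b c d → a + b + (c + d) ≡ a + c + (b + d)
  lem = solve-∀

∑-* : ∀ c f x k → ∑ (λ i → c * f i) x k ≡ c * ∑ f x k
∑-* c f x zero = sym (ℤ.*-zeroʳ c)
∑-* c f x (suc k) = trans (+-congˡ (c * f x) (∑-* c f (x + 1ℤ) k)) (sym (ℤ.*-distribˡ-+ c (f x) _))

∑-zero : ∀ x k → ∑ (λ _ → 0ℤ) x k ≡ 0ℤ
∑-zero x zero = refl
∑-zero x (suc k) = trans (ℤ.+-identityˡ _) (∑-zero (x + 1ℤ) k)

∑-nonneg : ∀ f x k → (∀ i → 0ℤ ≤ f i) → 0ℤ ≤ ∑ f x k
∑-nonneg f x zero h = ℤ.≤-refl
∑-nonneg f x (suc k) h = +-nonneg (h x) (∑-nonneg f (x + 1ℤ) k h)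

-- A sum over k + 1 consecutive positions can be split at either end; periodicity makes the two end
-- terms equal.
∑-window-suc : ∀ f k → (∀ i → f (i + + k) ≡ f i) → ∀ x → ∑ f (x + 1ℤ) k ≡ ∑ f x k
∑-window-suc f k per x = ℤ+.∙-cancelˡ (f x) _ _
  (trans (∑-last f x k) (trans (cong (λ a → ∑ f x k + a) (per x)) (ℤ.+-comm _ (f x))))

∑-window : ∀ f k → (∀ i → f (i + + k) ≡ f i) → ∀ x y → ∑ f x k ≡ ∑ f y k
∑-window f k per x y = trans (base x) (sym (base y))
  where
  base : ∀ x → ∑ f x k ≡ ∑ f 0ℤ k
  base = ℤ-ind _ refl (λ x p → trans (∑-window-suc f k per x) p)
                      (λ x p → trans (sym (∑-window-suc f k per x)) p)

-- Residues

periodic-ext : ∀ {k} .{{_ : ℕ.NonZero k}} (P : ℤ → Set) → (∀ x → P x → P (x + + k)) → (∀ x → P (x + + k) → P x) →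
  ∀ x₀ → (∀ r → r ℕ.< k → P (x₀ + + r)) → ∀ x → P x
periodic-ext {k} P up down x₀ base x =
  subst P eq (shift (x₀ + + ((x - x₀) %ℕ k)) (base _ (n%ℕd<d (x - x₀) k)) ((x - x₀) /ℕ k))
  where
  shift : ∀ y → P y → ∀ q → P (y + q * + k)
  shift y py = ℤ-ind (λ q → P (y + q * + k)) (subst P (lem₀ y) py)
    (λ q p → subst P (lem₁ y q (+ k)) (up _ p)) (λ q p → down _ (subst P (sym (lem₁ y q (+ k))) p))
    where
    lem₀ : ∀ y → y ≡ y + 0ℤ
    lem₀ y = sym (ℤ.+-identityʳ y)
    lem₁ : ∀ y q d → y + q * d + d ≡ y + (q + 1ℤ) * d
    lem₁ = solve-∀
  eq : x₀ + + ((x - x₀) %ℕ k) + (x - x₀) /ℕ k * + k ≡ x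
  eq = trans (ℤ.+-assoc x₀ _ _) (trans (+-congˡ x₀ (sym (a≡a%ℕn+[a/ℕn]*n (x - x₀) k))) (lem x x₀))
    where
    lem : ∀ x y → y + (x - y) ≡ x
    lem = solve-∀

shift-by : ∀ {k} (f : ℤ → ℤ) c → (∀ i → f (i + + k) ≡ f i + c) → ∀ i q → f (i + q * + k) ≡ f i + q * c
shift-by {k} f c per i = ℤ-ind _
  (trans (cong f (ℤ.+-identityʳ i)) (sym (ℤ.+-identityʳ (f i))))
  (λ q p → trans (cong f (lem i q (+ k))) (trans (per _) (trans (cong (_+ c) p) (sym (lem (f i) q c)))))
  (λ q p → ℤ+.∙-cancelʳ c _ _ (trans (sym (per _)) (trans (cong f (sym (lem i q (+ k)))) (trans p (lem (f i) q c)))))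
  where
  lem : ∀ y q d → y + (q + 1ℤ) * d ≡ y + q * d + d
  lem = solve-∀

-- Descents recur periodically, so searching one period either finds one or, through `periodic-ext`,
-- shows that there is none anywhere.
search : ∀ {P : ℤ → Set} → (∀ x → Dec (P x)) → ∀ x k → (∃ λ r → r ℕ.< k × P (x + + r)) ⊎ (∀ r → r ℕ.< k → ¬ P (x + + r))
search P? x zero = inj₂ λ _ ()
search {P} P? x (suc k) with P? (x + + k) | search P? x k
... | yes p | _ = inj₁ (k , ℕ.≤-refl , p)
... | no _ | inj₁ (r , r<k , p) = inj₁ (r , ℕ.m≤n⇒m≤1+n r<k , p)
... | no ¬p | inj₂ h = inj₂ go
  where
  go : ∀ r → r ℕ.< suc k → ¬ P (x + + r)
  go r (ℕ.s≤s r≤k) q with ℕ.m≤n⇒m<n∨m≡n r≤k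
  ... | inj₁ r<k = h r r<k q
  ... | inj₂ refl = ¬p q

residue-unique : ∀ {k} a b q → a ℕ.< k → b ℕ.< k → + a ≡ + b + q * + k → q ≡ 0ℤ
residue-unique {k} a b (+ zero) _ _ _ = refl
residue-unique {k} a b (+ suc q) a<k _ eq = contradiction a<k
  (ℕ.≤⇒≯ (subst (k ℕ.≤_) (sym (ℤ.+-injective (trans eq (trans (+-congˡ (+ b) (sym (ℤ.pos-* (suc q) k))) (sym (ℤ.pos-+ b _))))))
    (ℕ.≤-trans (ℕ.m≤m+n k (q ℕ.* k)) (ℕ.m≤n+m _ b))))
residue-unique {k} a b -[1+ q ] _ b<k eq = contradiction b<k
  (ℕ.≤⇒≯ (subst (k ℕ.≤_) (ℤ.+-injective (trans (ℤ.pos-+ a _) (trans (+-congˡ (+ a) (ℤ.pos-* (suc q) k)) eq′)))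
    (ℕ.≤-trans (ℕ.m≤m+n k (q ℕ.* k)) (ℕ.m≤n+m _ a))))
  where
  lem : ∀ b c k → b + (- c) * k + c * k ≡ b
  lem = solve-∀
  eq′ : + a + + suc q * + k ≡ + b
  eq′ = trans (cong (_+ + suc q * + k) eq) (lem (+ b) (+ suc q) (+ k))

-- Floors are computed below by exhibiting a quotient together with a remainder in range.
/ℕ-unique : ∀ {k} .{{_ : ℕ.NonZero k}} x r q → r ℕ.< k → x ≡ + r + q * + k → x /ℕ k ≡ q
/ℕ-unique {k} x r q r<k eq = trans (lem (x /ℕ k) q)
  (trans (+-congˡ q (residue-unique r (x %ℕ k) (x /ℕ k - q) r<k (n%ℕd<d x k)
    (lem₂ (+ r) q (+ (x %ℕ k)) (x /ℕ k) (+ k) (trans (sym eq) (a≡a%ℕn+[a/ℕn]*n x k)))))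
    (ℤ.+-identityʳ q))
  where
  lem : ∀ a b → a ≡ b + (a - b)
  lem = solve-∀
  lem₂ : ∀ r q r′ q′ k → r + q * k ≡ r′ + q′ * k → r ≡ r′ + (q′ - q) * k
  lem₂ r q r′ q′ k eq = trans (l₃ r (q * k)) (trans (cong (_- q * k) eq) (l₄ r′ q′ k q))
    where
    l₃ : ∀ r a → r ≡ r + a - a
    l₃ = solve-∀
    l₄ : ∀ r′ q′ k q → r′ + q′ * k - q * k ≡ r′ + (q′ - q) * k
    l₄ = solve-∀

+-cancelʳ-< : ∀ c {x y} → x + c < y + c → x < y
+-cancelʳ-< c {x} {y} p = <-from _ (gap< p) (lem x y c)
  where
  lem : ∀ x y c → y ≡ x + 1ℤ + (y + c - (x + c) - 1ℤ)
  lem = solve-∀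

-- Lists of consecutive integers and finite sums

rng : ℤ → ℕ → List ℤ
rng x zero = []
rng x (suc k) = x ∷ rng (x + 1ℤ) k

range1≡rng : ∀ n → range1 n ≡ rng 1ℤ n
range1≡rng n = go (λ k → k) 1ℤ n (λ _ → refl)
  where
  go : ∀ h x k → (∀ i → + suc (h i) ≡ x + + i) → map (λ k → + suc k) (applyUpTo h k) ≡ rng x k
  go h x zero eq = refl
  go h x (suc k) eq = cong₂ _∷_ (trans (eq 0) (ℤ.+-identityʳ x))
    (go (λ i → h (suc i)) (x + 1ℤ) k λ i → trans (eq (suc i)) (+-suc-assoc x i))

sumℤ-rng : ∀ f x k → sumℤ (map f (rng x k)) ≡ ∑ f x k
sumℤ-rng f x zero = refl
sumℤ-rng f x (suc k) = +-congˡ (f x) (sumℤ-rng f (x + 1ℤ) k)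

sumℤ-range1 : ∀ f n → sumℤ (map f (range1 n)) ≡ ∑ f 1ℤ n
sumℤ-range1 f n = trans (cong (λ xs → sumℤ (map f xs)) (range1≡rng n)) (sumℤ-rng f 1ℤ n)

open FinSum ℤ.+-0-commutativeMonoid using (sum; sum-permute; sum-cong-≗)

-- Passage to sums over `Fin`, where invariance under permutations is available as `sum-permute`.
∑-sum : ∀ f x k → ∑ f x k ≡ sum {k} (λ i → f (x + + toℕ i))
∑-sum f x zero = refl
∑-sum f x (suc k) = cong₂ _+_ (cong f (sym (ℤ.+-identityʳ x)))
  (trans (∑-sum f (x + 1ℤ) k) (sum-cong-≗ {k} λ i → cong f (sym (+-suc-assoc x (toℕ i)))))

%ℕ-unique : ∀ {k} .{{_ : ℕ.NonZero k}} x r q → r ℕ.< k → x ≡ + r + q * + k → x %ℕ k ≡ r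
%ℕ-unique {k} x r q r<k eq = ℤ.+-injective (ℤ+.∙-cancelʳ (q * + k) _ _
  (trans (+-congˡ (+ (x %ℕ k)) (cong (_* + k) (sym (/ℕ-unique x r q r<k eq))))
    (trans (sym (a≡a%ℕn+[a/ℕn]*n x k)) eq)))

-- The group of affine permutations

module Affine (n : ℕ) (2≤n : 2 ℕ.≤ n) where

  instance
    nonZero : ℕ.NonZero n
    nonZero = ℕ.>-nonZero (ℕ.≤-trans (ℕ.s≤s ℕ.z≤n) 2≤n)

  N : ℤ
  N = + n

  Quasi : (ℤ → ℤ) → Set
  Quasi h = ∀ i → h (i + N) ≡ h i + N

  quasi-shift : ∀ h → Quasi h → ∀ i q → h (i + q * N) ≡ h i + q * N
  quasi-shift h per = shift-by h N per

  inv-periodic : (w : AffPerm n) → Quasi (inv w)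
  inv-periodic w i = trans (cong (λ x → inv w (x + N)) (sym (fun-inv w i)))
    (trans (cong (inv w) (sym (periodic w (inv w i)))) (inv-fun w (inv w i + N)))

  res : ℤ → Fin n
  res x = fromℕ< (n%ℕd<d x n)

  res-quot : ∀ x → + toℕ (res x) ≡ x + (- (x /ℕ n)) * N
  res-quot x = trans (cong +_ (Fin.toℕ-fromℕ< (n%ℕd<d x n)))
    (trans (lem (+ (x %ℕ n)) (x /ℕ n) N) (cong (λ y → y + (- (x /ℕ n)) * N) (sym (a≡a%ℕn+[a/ℕn]*n x n))))
    where
    lem : ∀ r q k → r ≡ r + q * k + (- q) * k
    lem = solve-∀

  res-unique : ∀ x (i : Fin n) q → x ≡ + toℕ i + q * N → res x ≡ i
  res-unique x i q eq = Fin.toℕ-injective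
    (trans (Fin.toℕ-fromℕ< _) (%ℕ-unique x (toℕ i) q (Fin.toℕ<n i) eq))

  periodic-res : ∀ {f : ℤ → ℤ} → (∀ i → f (i + N) ≡ f i) → ∀ x → f (+ toℕ (res x)) ≡ f x
  periodic-res {f} per x = trans (cong f (res-quot x))
    (trans (shift-by f 0ℤ (λ i → trans (per i) (sym (ℤ.+-identityʳ (f i)))) x (- (x /ℕ n)))
      (trans (+-congˡ (f x) (ℤ.*-zeroʳ (- (x /ℕ n)))) (ℤ.+-identityʳ (f x))))

  res-perm : AffPerm n → Permutation n n
  res-perm w = permutation (to (fun w)) (to (inv w))
      (roundtrip (fun w) (inv w) (periodic w) (fun-inv w)) (roundtrip (inv w) (fun w) (inv-periodic w) (inv-fun w))
    where
    to : (ℤ → ℤ) → Fin n → Fin n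
    to h i = res (h (+ toℕ i))
    roundtrip : ∀ h g → Quasi h → (∀ i → h (g i) ≡ i) → ∀ i → to h (to g i) ≡ i
    roundtrip h g per hg i = res-unique _ i (- (g (+ toℕ i) /ℕ n))
      (trans (cong h (res-quot (g (+ toℕ i)))) (trans (quasi-shift h per (g (+ toℕ i)) (- (g (+ toℕ i) /ℕ n))) (cong (_+ (- (g (+ toℕ i) /ℕ n)) * N) (hg (+ toℕ i)))))

  -- A periodic f depends only on the residue, and w permutes the residues through `res-perm`.
  ∑-permute : (w : AffPerm n) → ∀ f → (∀ i → f (i + N) ≡ f i) → ∀ x → ∑ (λ i → f (fun w i)) x n ≡ ∑ f x n
  ∑-permute w f per x = trans (∑-window _ n (λ i → trans (cong f (periodic w i)) (per (fun w i))) x 0ℤ)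
    (trans base (∑-window f n per 0ℤ x))
    where
    base : ∑ (λ i → f (fun w i)) 0ℤ n ≡ ∑ f 0ℤ n
    base = trans (∑-sum _ 0ℤ n) (trans
      (sum-cong-≗ {n} λ i → trans (cong (λ y → f (fun w y)) (ℤ.+-identityˡ (+ toℕ i)))
        (trans (sym (periodic-res per (fun w (+ toℕ i)))) (cong f (sym (ℤ.+-identityˡ _)))))
      (trans (sym (sum-permute {n} {n} (λ i → f (0ℤ + + toℕ i)) (res-perm w))) (sym (∑-sum f 0ℤ n))))

  excess-periodic : ∀ h → Quasi h → ∀ i → h (i + N) - (i + N) ≡ h i - i
  excess-periodic h per i = trans (cong (_- (i + N)) (per i)) (lem (h i) i N)
    where
    lem : ∀ a b c → a + c - (b + c) ≡ a - b
    lem = solve-∀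

  ∑-minus : ∀ f g x k → ∑ f x k ≡ ∑ (λ i → f i - g i) x k + ∑ g x k
  ∑-minus f g x k = trans (∑-cong-all x k (λ i → lem (f i) (g i))) (∑-+ (λ i → f i - g i) g x k)
    where
    lem : ∀ a b → a ≡ a - b + b
    lem = solve-∀

  -- The excess h i - i is periodic, so the normalisation of the window sum amounts to zero total
  -- excess over any one period, which may be chosen to suit h.
  sumCond-intro : ∀ h → Quasi h → ∀ x → ∑ (λ i → h i - i) x n ≡ 0ℤ → sumℤ (map h (range1 n)) ≡ sumℤ (range1 n)
  sumCond-intro h per x eq = trans (sumℤ-range1 h n) (trans (∑-minus h (λ i → i) 1ℤ n)
    (trans (cong (_+ ∑ (λ i → i) 1ℤ n) (trans (∑-window _ n (excess-periodic h per) 1ℤ x) eq))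
      (trans (ℤ.+-identityˡ _) (trans (sym (sumℤ-range1 (λ i → i) n)) (cong sumℤ (map-id (range1 n)))))))

  excess≡0 : (w : AffPerm n) → ∀ x → ∑ (λ i → fun w i - i) x n ≡ 0ℤ
  excess≡0 w x = trans (∑-window _ n (excess-periodic (fun w) (periodic w)) x 1ℤ)
    (ℤ+.∙-cancelʳ (∑ (λ i → i) 1ℤ n) _ _ (trans (sym (∑-minus (fun w) (λ i → i) 1ℤ n))
      (trans (sym (sumℤ-range1 (fun w) n)) (trans (sumCond w)
        (trans (trans (cong sumℤ (sym (map-id (range1 n)))) (sumℤ-range1 (λ i → i) n)) (sym (ℤ.+-identityˡ _)))))))

  infixr 9 _∘ₐ_
  _∘ₐ_ : AffPerm n → AffPerm n → AffPerm n
  fun (u ∘ₐ w) i = fun u (fun w i)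
  inv (u ∘ₐ w) i = inv w (inv u i)
  inv-fun (u ∘ₐ w) i = trans (cong (inv w) (inv-fun u (fun w i))) (inv-fun w i)
  fun-inv (u ∘ₐ w) i = trans (cong (fun u) (fun-inv w (inv u i))) (fun-inv u i)
  periodic (u ∘ₐ w) i = trans (cong (fun u) (periodic w i)) (periodic u (fun w i))
  -- The excess splits as (u (w i) - w i) + (w i - i); the first part is the excess of u reindexed
  -- by w.
  sumCond (u ∘ₐ w) = sumCond-intro (fun (u ∘ₐ w)) (periodic (u ∘ₐ w)) 1ℤ
    (trans (∑-cong-all 1ℤ n (λ i → lem (fun u (fun w i)) (fun w i) i))
    (trans (∑-+ (λ i → fun u (fun w i) - fun w i) (λ i → fun w i - i) 1ℤ n)
      (cong₂ _+_ (trans (∑-permute w (λ i → fun u i - i) (excess-periodic (fun u) (periodic u)) 1ℤ) (excess≡0 u 1ℤ))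
        (excess≡0 w 1ℤ))))
    where
    lem : ∀ a b c → a - c ≡ a - b + (b - c)
    lem = solve-∀

  _⁻¹ₐ : AffPerm n → AffPerm n
  fun (w ⁻¹ₐ) = inv w
  inv (w ⁻¹ₐ) = fun w
  inv-fun (w ⁻¹ₐ) = fun-inv w
  fun-inv (w ⁻¹ₐ) = inv-fun w
  periodic (w ⁻¹ₐ) = inv-periodic w
  -- Reindexing by w turns the excess of the inverse into the negative of the excess of w.
  sumCond (w ⁻¹ₐ) = sumCond-intro (inv w) (inv-periodic w) 1ℤ
    (trans (sym (∑-permute w (λ i → inv w i - i) (excess-periodic (inv w) (inv-periodic w)) 1ℤ))
    (trans (∑-cong-all 1ℤ n (λ i → trans (cong (_- fun w i) (inv-fun w i)) (lem i (fun w i))))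
    (trans (∑-* (- 1ℤ) (λ i → fun w i - i) 1ℤ n) (cong (- 1ℤ *_) (excess≡0 w 1ℤ)))))
    where
    lem : ∀ a b → a - b ≡ - 1ℤ * (b - a)
    lem = solve-∀

  idₐ : AffPerm n
  fun idₐ i = i
  inv idₐ i = i
  inv-fun idₐ i = refl
  fun-inv idₐ i = refl
  periodic idₐ i = refl
  sumCond idₐ = cong sumℤ (map-id (range1 n))

  fun-injective : (w : AffPerm n) → ∀ {i j} → fun w i ≡ fun w j → i ≡ j
  fun-injective w {i} {j} eq = trans (sym (inv-fun w i)) (trans (cong (inv w) eq) (inv-fun w j))

  inv-injective : (w : AffPerm n) → ∀ {i j} → inv w i ≡ inv w j → i ≡ j
  inv-injective w = fun-injective (w ⁻¹ₐ)

  ≈⇒inv : ∀ {u w : AffPerm n} → u ≈ w → ∀ i → inv u i ≡ inv w i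
  ≈⇒inv {u} {w} u≈w i = fun-injective u (trans (fun-inv u i) (trans (sym (fun-inv w i)) (sym (u≈w (inv w i)))))

  -- Simple reflections

  Multiple : ℤ → Set
  Multiple x = ∃ λ q → x ≡ q * N

  ∣⇒Multiple : ∀ {x} → n ℕD.∣ ∣ x ∣ → Multiple x
  ∣⇒Multiple {x} d with ℤD.∣ᵤ⇒∣ {N} {x} d
  ... | ℤD.divides q eq = q , eq

  Multiple⇒∣ : ∀ {x} → Multiple x → n ℕD.∣ ∣ x ∣
  Multiple⇒∣ {x} (q , eq) = ℤD.∣⇒∣ᵤ {N} {x} (ℤD.divides q eq)

  residue≢0 : ∀ r q → 0 ℕ.< r → r ℕ.< n → ¬ Multiple (+ r + q * N)
  residue≢0 r q 0<r r<n (q′ , eq) = ℕ.<⇒≢ 0<r (sym (trans (sym (%ℕ-unique _ r q r<n refl))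
    (%ℕ-unique _ 0 q′ (ℕ.≤-trans (ℕ.s≤s ℕ.z≤n) 2≤n) (trans eq (sym (ℤ.+-identityˡ (q′ * N)))))))

  s-hit₀ : ∀ i j → Multiple (j - i) → s n i j ≡ j + 1ℤ
  s-hit₀ i j m with n ℕD.∣? ∣ j - i ∣
  ... | yes _ = refl
  ... | no ¬d = contradiction (Multiple⇒∣ m) ¬d

  -- `s` tests for the residue of i first, so that test has to be refuted here: the residues of i
  -- and i + 1 differ by 1, which is no multiple of n because n ≥ 2.
  s-hit₁ : ∀ i j → Multiple (j - (i + 1ℤ)) → s n i j ≡ j - 1ℤ
  s-hit₁ i j m with n ℕD.∣? ∣ j - i ∣
  ... | yes d = contradiction (∣⇒Multiple {j - i} d)
                  λ d′ → residue≢0 1 (proj₁ m) (ℕ.s≤s ℕ.z≤n) 2≤n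
                    (proj₁ d′ , trans (trans (+-congˡ 1ℤ (sym (proj₂ m))) (lem i j)) (proj₂ d′))
    where
    lem : ∀ i j → 1ℤ + (j - (i + 1ℤ)) ≡ j - i
    lem = solve-∀
  ... | no _ with n ℕD.∣? ∣ j - (i + + 1) ∣
  ...   | yes _ = refl
  ...   | no ¬d = contradiction (Multiple⇒∣ m) ¬d

  s-miss : ∀ i j → ¬ Multiple (j - i) → ¬ Multiple (j - (i + 1ℤ)) → s n i j ≡ j
  s-miss i j ¬m₀ ¬m₁ with n ℕD.∣? ∣ j - i ∣
  ... | yes d = contradiction (∣⇒Multiple d) ¬m₀
  ... | no _ with n ℕD.∣? ∣ j - (i + + 1) ∣
  ...   | yes d = contradiction (∣⇒Multiple d) ¬m₁
  ...   | no _ = refl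

  multiple? : ∀ x → Dec (Multiple x)
  multiple? x with n ℕD.∣? ∣ x ∣
  ... | yes d = yes (∣⇒Multiple d)
  ... | no ¬d = no λ m → ¬d (Multiple⇒∣ m)

  data SView (i j : ℤ) : Set where
    hit₀ : Multiple (j - i) → s n i j ≡ j + 1ℤ → SView i j
    hit₁ : Multiple (j - (i + 1ℤ)) → s n i j ≡ j - 1ℤ → SView i j
    miss : ¬ Multiple (j - i) → ¬ Multiple (j - (i + 1ℤ)) → s n i j ≡ j → SView i j

  s-view : ∀ i j → SView i j
  s-view i j with multiple? (j - i) | multiple? (j - (i + 1ℤ))
  ... | yes m | _ = hit₀ m (s-hit₀ i j m)
  ... | no _ | yes m = hit₁ m (s-hit₁ i j m)
  ... | no ¬m₀ | no ¬m₁ = miss ¬m₀ ¬m₁ (s-miss i j ¬m₀ ¬m₁)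

  Multiple-shift : ∀ {x y} → x ≡ y + N → Multiple y → Multiple x
  Multiple-shift eq (q , e) = q + 1ℤ , trans eq (trans (cong (_+ N) e) (lem q N))
    where
    lem : ∀ q k → q * k + k ≡ (q + 1ℤ) * k
    lem = solve-∀

  Multiple-unshift : ∀ {x y} → x ≡ y + N → Multiple x → Multiple y
  Multiple-unshift {x} {y} eq (q , e) = q - 1ℤ , ℤ+.∙-cancelʳ N _ _ (trans (trans (sym eq) e) (lem q N))
    where
    lem : ∀ q k → q * k ≡ (q - 1ℤ) * k + k
    lem = solve-∀

  s-self : ∀ i → s n i i ≡ i + 1ℤ
  s-self i = s-hit₀ i i (0ℤ , ℤ.+-inverseʳ i)

  s-next : ∀ i → s n i (i + 1ℤ) ≡ i
  s-next i = trans (s-hit₁ i (i + 1ℤ) (0ℤ , ℤ.+-inverseʳ (i + 1ℤ))) (solve (i ∷ []))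

  s-far : ∀ i r → 2 ℕ.≤ r → r ℕ.< n → s n i (i + + r) ≡ i + + r
  s-far i (suc r) 2≤r r<n = s-miss i (i + + suc r)
    (λ m → residue≢0 (suc r) 0ℤ (ℕ.s≤s ℕ.z≤n) r<n (subst Multiple (lem₀ i (+ suc r) N) m))
    (λ m → residue≢0 r 0ℤ (ℕ.s≤s⁻¹ 2≤r) (ℕ.<-trans (ℕ.n<1+n r) r<n)
      (subst Multiple (trans (cong (λ y → i + y - (i + 1ℤ)) (+suc r)) (lem₁ i (+ r) N)) m))
    where
    lem₀ : ∀ i r k → i + r - i ≡ r + 0ℤ * k
    lem₀ = solve-∀
    lem₁ : ∀ i r k → i + (r + 1ℤ) - (i + 1ℤ) ≡ r + 0ℤ * k
    lem₁ = solve-∀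

  s-quasi : ∀ i → Quasi (s n i)
  s-quasi i j with s-view i j
  ... | hit₀ m eq = trans (s-hit₀ i (j + N) (Multiple-shift (lem j N i) m)) (trans (lem′ j N) (cong (_+ N) (sym eq)))
    where
    lem : ∀ j k i → j + k - i ≡ j - i + k
    lem = solve-∀
    lem′ : ∀ j k → j + k + 1ℤ ≡ j + 1ℤ + k
    lem′ = solve-∀
  ... | hit₁ m eq = trans (s-hit₁ i (j + N) (Multiple-shift (lem j N i) m)) (trans (lem′ j N) (cong (_+ N) (sym eq)))
    where
    lem : ∀ j k i → j + k - (i + 1ℤ) ≡ j - (i + 1ℤ) + k
    lem = solve-∀
    lem′ : ∀ j k → j + k - 1ℤ ≡ j - 1ℤ + k
    lem′ = solve-∀
  ... | miss ¬m₀ ¬m₁ eq = trans (s-miss i (j + N) (λ m → ¬m₀ (Multiple-unshift (lem₀ j N i) m))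
                                         (λ m → ¬m₁ (Multiple-unshift (lem₁ j N i) m))) (cong (_+ N) (sym eq))
    where
    lem₀ : ∀ j k i → j + k - i ≡ j - i + k
    lem₀ = solve-∀
    lem₁ : ∀ j k i → j + k - (i + 1ℤ) ≡ j - (i + 1ℤ) + k
    lem₁ = solve-∀

  window-cases : ∀ (P : ℤ → Set) → (∀ x → P x → P (x + N)) → (∀ x → P (x + N) → P x) → ∀ i →
    P i → P (i + 1ℤ) → (∀ r → 2 ℕ.≤ r → r ℕ.< n → P (i + + r)) → ∀ x → P x
  window-cases P up down i p₀ p₁ p = periodic-ext P up down i base
    where
    base : ∀ r → r ℕ.< n → P (i + + r)
    base zero _ = subst P (sym (ℤ.+-identityʳ i)) p₀
    base (suc zero) _ = p₁
    base (suc (suc r)) r<n = p (suc (suc r)) (ℕ.s≤s (ℕ.s≤s ℕ.z≤n)) r<n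

  s-involutive : ∀ i j → s n i (s n i j) ≡ j
  s-involutive i = window-cases _
    (λ x e → trans (cong (s n i) (s-quasi i x)) (trans (s-quasi i _) (cong (_+ N) e)))
    (λ x e → ℤ+.∙-cancelʳ N _ _ (trans (sym (s-quasi i _)) (trans (sym (cong (s n i) (s-quasi i x))) e)))
    i
    (trans (cong (s n i) (s-self i)) (s-next i))
    (trans (cong (s n i) (s-next i)) (s-self i))
    (λ r 2≤r r<n → trans (cong (s n i) (s-far i r 2≤r r<n)) (s-far i r 2≤r r<n))

  gen : ℤ → AffPerm n
  fun (gen i) = s n i
  inv (gen i) = s n i
  inv-fun (gen i) = s-involutive i
  fun-inv (gen i) = s-involutive i
  periodic (gen i) = s-quasi i
  -- In the window that starts at i the excess is 1, then -1, then zero.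
  sumCond (gen i) = sumCond-intro (s n i) (s-quasi i) i (total n 2≤n (s-far i))
    where
    lem : ∀ i k → i + 1ℤ - i + (i - (i + 1ℤ) + k) ≡ k
    lem = solve-∀
    total : ∀ k → 2 ℕ.≤ k → (∀ r → 2 ℕ.≤ r → r ℕ.< k → s n i (i + + r) ≡ i + + r) → ∑ (λ j → s n i j - j) i k ≡ 0ℤ
    total (suc zero) (ℕ.s≤s ()) _
    total (suc (suc k)) _ far = trans (cong₂ (λ a b → a - i + (b - (i + 1ℤ) + ∑ (λ j → s n i j - j) (i + 1ℤ + 1ℤ) k)) (s-self i) (s-next i))
      (trans (lem i _) (trans (∑-cong {λ j → s n i j - j} {λ _ → 0ℤ} (i + 1ℤ + 1ℤ) k rest) (∑-zero (i + 1ℤ + 1ℤ) k)))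
      where
      rest : ∀ r → r ℕ.< k → s n i (i + 1ℤ + 1ℤ + + r) - (i + 1ℤ + 1ℤ + + r) ≡ 0ℤ
      rest r r<k = subst (λ y → s n i y - y ≡ 0ℤ) (trans (+-suc-assoc i (suc r)) (+-suc-assoc (i + 1ℤ) r))
        (trans (cong (_- (i + + suc (suc r))) (far (suc (suc r)) (ℕ.s≤s (ℕ.s≤s ℕ.z≤n)) (ℕ.s≤s (ℕ.s≤s r<k))))
          (ℤ.+-inverseʳ (i + + suc (suc r))))

  swap : ℤ → AffPerm n → AffPerm n
  swap i w = gen i ∘ₐ w

-- Increasing functions and sums over pairs of positions

<⇒∃ : ∀ {i j} → i < j → ∃ λ t → j ≡ i + + suc t
<⇒∃ {i} {j} i<j = ∣ j - i - 1ℤ ∣ , trans (trans (lem i j) (+-congˡ (i + 1ℤ) (sym (ℤ.0≤i⇒+∣i∣≡i (gap< i<j)))))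
  (sym (+-suc-assoc i _))
  where
  lem : ∀ i j → j ≡ i + 1ℤ + (j - i - 1ℤ)
  lem = solve-∀

module _ (f : ℤ → ℤ) (f< : ∀ i → f i < f (i + 1ℤ)) where

  increasing-growth : ∀ i t → f i + + t ≤ f (i + + t)
  increasing-growth i zero = ℤ.≤-reflexive (trans (ℤ.+-identityʳ (f i)) (cong f (sym (ℤ.+-identityʳ i))))
  increasing-growth i (suc t) = subst₂ _≤_ (lem (f i) t) (cong f (lem i t))
    (ℤ.≤-trans (ℤ.+-monoˡ-≤ 1ℤ (increasing-growth i t)) (<⇒suc≤ (f< (i + + t))))
    where
    lem : ∀ x t → x + + t + 1ℤ ≡ x + + suc t
    lem x t = trans (ℤ.+-assoc x (+ t) 1ℤ) (+-congˡ x (sym (+suc t)))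

  increasing-mono : ∀ {i j} → i < j → f i < f j
  increasing-mono {i} i<j with <⇒∃ i<j
  ... | t , refl = ℤ.<-≤-trans
    (<-from (+ t) (+≤+ ℕ.z≤n) (+-suc-assoc (f i) t)) (increasing-growth i (suc t))

  increasing-mono-≤ : ∀ {i j} → i ≤ j → f i ≤ f j
  increasing-mono-≤ {i} {j} i≤j with i ≟ j
  ... | yes refl = ℤ.≤-refl
  ... | no i≢j = ℤ.<⇒≤ (increasing-mono (ℤ.≤∧≢⇒< i≤j i≢j))

  increasing-reflects : ∀ {i j} → f i < f j → i < j
  increasing-reflects {i} {j} fi<fj with <-or-≥ i j
  ... | inj₁ i<j = i<j
  ... | inj₂ j≤i = contradiction fi<fj (ℤ.≤⇒≯ (increasing-mono-≤ j≤i))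

∑-const : ∀ c x k → ∑ (λ _ → c) x k ≡ + k * c
∑-const c x zero = refl
∑-const c x (suc k) = trans (+-congˡ c (∑-const c (x + 1ℤ) k))
  (trans (lem c (+ k)) (cong (_* c) (sym (+suc k))))
  where
  lem : ∀ c k → c + k * c ≡ (k + 1ℤ) * c
  lem = solve-∀

∑₂ : (ℤ → ℤ → ℤ) → ℤ → ℕ → ℤ
∑₂ g x zero = 0ℤ
∑₂ g x (suc k) = ∑ (g x) (x + 1ℤ) k + ∑₂ g (x + 1ℤ) k

-- The definition peels off the first index. Peeling off the last one as well is what sliding a
-- window by one position requires.
∑₂-last : ∀ g x k → ∑₂ g x (suc k) ≡ ∑₂ g x k + ∑ (λ i → g i (x + + k)) x k
∑₂-last g x zero = refl
∑₂-last g x (suc k) = trans (cong₂ _+_ (∑-last (g x) (x + 1ℤ) k) (∑₂-last g (x + 1ℤ) k))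
  (trans (cong (λ y → ∑ (g x) (x + 1ℤ) k + g x y + (∑₂ g (x + 1ℤ) k + ∑ (λ i → g i y) (x + 1ℤ) k)) (sym (+-suc-assoc x k)))
    (lem (∑ (g x) (x + 1ℤ) k) (g x (x + + suc k)) (∑₂ g (x + 1ℤ) k) (∑ (λ i → g i (x + + suc k)) (x + 1ℤ) k)))
  where
  lem : ∀ a b c d → a + b + (c + d) ≡ a + c + (b + d)
  lem = solve-∀

∑₂-cong : ∀ {g h} x k → (∀ r r′ → r ℕ.< r′ → r′ ℕ.< k → g (x + + r) (x + + r′) ≡ h (x + + r) (x + + r′)) → ∑₂ g x k ≡ ∑₂ h x k
∑₂-cong x zero eq = refl
∑₂-cong {g} {h} x (suc k) eq = cong₂ _+_
  (∑-cong (x + 1ℤ) k λ r r<k → subst₂ (λ a b → g a b ≡ h a b) (ℤ.+-identityʳ x) (+-suc-assoc x r)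
    (eq 0 (suc r) (ℕ.s≤s ℕ.z≤n) (ℕ.s≤s r<k)))
  (∑₂-cong (x + 1ℤ) k λ r r′ r<r′ r′<k → subst₂ (λ a b → g a b ≡ h a b) (+-suc-assoc x r) (+-suc-assoc x r′)
    (eq (suc r) (suc r′) (ℕ.s≤s r<r′) (ℕ.s≤s r′<k)))

∑₂-nonneg : ∀ g x k → (∀ i j → 0ℤ ≤ g i j) → 0ℤ ≤ ∑₂ g x k
∑₂-nonneg g x zero h = ℤ.≤-refl
∑₂-nonneg g x (suc k) h = +-nonneg (∑-nonneg (g x) (x + 1ℤ) k (h x)) (∑₂-nonneg g (x + 1ℤ) k h)

∑₂-zero : ∀ x k → ∑₂ (λ _ _ → 0ℤ) x k ≡ 0ℤ
∑₂-zero x zero = refl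
∑₂-zero x (suc k) = cong₂ _+_ (∑-zero (x + 1ℤ) k) (∑₂-zero (x + 1ℤ) k)

-- Coxeter length as an inversion count

module Length (n : ℕ) (2≤n : 2 ℕ.≤ n) where
  open Affine n 2≤n public

  floor-+N : ∀ x → (x + N) /ℕ n ≡ x /ℕ n + 1ℤ
  floor-+N x = /ℕ-unique (x + N) (x %ℕ n) _ (n%ℕd<d x n)
    (trans (cong (_+ N) (a≡a%ℕn+[a/ℕn]*n x n)) (lem (+ (x %ℕ n)) (x /ℕ n) N))
    where
    lem : ∀ r q k → r + q * k + k ≡ r + (q + 1ℤ) * k
    lem = solve-∀

  -- Writing x = r + q n with 0 < r < n gives -x = (n - r) + (-1 - q) n, and n - r is again a valid
  -- remainder precisely because r is not 0.
  floor-neg : ∀ x → ¬ Multiple x → (- x) /ℕ n ≡ - 1ℤ - x /ℕ n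
  floor-neg x ¬m with x %ℕ n in eq | n%ℕd<d x n | a≡a%ℕn+[a/ℕn]*n x n
  ... | zero | _ | x≡ = contradiction (x /ℕ n , trans x≡ (ℤ.+-identityˡ _)) ¬m
  ... | suc r | r<n | x≡ = /ℕ-unique (- x) (n ℕ.∸ suc r) _ (ℕ.∸-monoʳ-< {o = 0} (ℕ.s≤s ℕ.z≤n) (ℕ.<⇒≤ r<n))
    (trans (cong -_ x≡) (lem (+ suc r) (+ (n ℕ.∸ suc r)) (x /ℕ n) N
      (trans (cong +_ (sym (ℕ.m+[n∸m]≡n (ℕ.<⇒≤ r<n)))) (ℤ.pos-+ (suc r) _))))
    where
    lem : ∀ r r′ q k → k ≡ r + r′ → - (r + q * k) ≡ r′ + (- 1ℤ - q) * k
    lem r r′ q _ refl = lem′ r r′ q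
      where
      lem′ : ∀ r r′ q → - (r + q * (r + r′)) ≡ r′ + (- 1ℤ - q) * (r + r′)
      lem′ = solve-∀

  -- Shi's formula: the inversions of v between the residue classes of i < j < i + n
  -- number ∣ ⌊ (v j - v i) / n ⌋ ∣.
  height : (ℤ → ℤ) → ℤ → ℤ → ℤ
  height v i j = + ∣ (v j - v i) /ℕ n ∣

  neg-sub : ∀ a b → a - b ≡ - (b - a)
  neg-sub = solve-∀

  -- With q = ⌊(b - a) / n⌋ ≥ 0 the opposite difference has floor -1 - q, whose absolute value is q
  -- + 1.
  height-swap : ∀ a b → a < b → ¬ Multiple (b - a) → + ∣ (a - b) /ℕ n ∣ ≡ + ∣ (b - a) /ℕ n ∣ + 1ℤ
  height-swap a b a<b ¬m = trans (cong (λ x → + ∣ x /ℕ n ∣) (neg-sub a b))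
    (trans (cong (λ x → + ∣ x ∣) (floor-neg (b - a) ¬m))
    (trans (cong +_ (trans (cong ∣_∣ (lem q)) (ℤ.∣-i∣≡∣i∣ (q + 1ℤ))))
    (trans (ℤ.0≤i⇒+∣i∣≡i (+-nonneg 0≤q (+≤+ ℕ.z≤n))) (cong (_+ 1ℤ) (sym (ℤ.0≤i⇒+∣i∣≡i 0≤q))))))
    where
    q = (b - a) /ℕ n
    0≤q : 0ℤ ≤ q
    0≤q = 0≤n⇒0≤n/ℕd (b - a) n (gap (ℤ.<⇒≤ a<b))
    lem : ∀ q → - 1ℤ - q ≡ - (q + 1ℤ)
    lem = solve-∀

  -- If the two values differed by q n, periodicity and injectivity would make the positions differ
  -- by q n as well, but 0 < r < n.
  distinct : (w : AffPerm n) → ∀ i r → 0 ℕ.< r → r ℕ.< n → ¬ Multiple (inv w (i + + r) - inv w i)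
  distinct w i r 0<r r<n (q , eq) = residue≢0 r 0ℤ 0<r r<n (q , trans (ℤ.+-identityʳ (+ r)) r≡)
    where
    lem : ∀ a b c → a - b ≡ c → a ≡ b + c
    lem a b _ refl = lem′ a b
      where
      lem′ : ∀ a b → a ≡ b + (a - b)
      lem′ = solve-∀
    r≡ : + r ≡ q * N
    r≡ = ℤ+.∙-cancelˡ i _ _ (inv-injective w (trans (lem _ _ _ eq) (sym (quasi-shift (inv w) (inv-periodic w) i q))))

  inversions : AffPerm n → ℤ → ℤ
  inversions w x = ∑₂ (height (inv w)) x n

  -- Sliding the window replaces x by x + n as partner of each x + r. The floor belonging to the new
  -- pair is (-1 - q) + 1 = -q, where q is the old one, so the heights agree.
  inversions-suc : ∀ w x → inversions w (x + 1ℤ) ≡ inversions w x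
  inversions-suc w x = go n refl
    where
    v = inv w
    swap-ends : ∀ r → 0 ℕ.< r → r ℕ.< n → height v (x + + r) (x + N) ≡ height v x (x + + r)
    swap-ends r 0<r r<n = cong +_ (trans (cong (λ y → ∣ y /ℕ n ∣) (trans (cong (_- v (x + + r)) (inv-periodic w x)) (lem (v x) (v (x + + r)) N)))
      (trans (cong ∣_∣ (trans (floor-+N (- (v (x + + r) - v x))) (trans (cong (_+ 1ℤ) (floor-neg _ (distinct w x r 0<r r<n))) (lem₁ ((v (x + + r) - v x) /ℕ n)))))
        (ℤ.∣-i∣≡∣i∣ ((v (x + + r) - v x) /ℕ n))))
      where
      lem : ∀ a b k → a + k - b ≡ - (b - a) + k
      lem = solve-∀
      lem₁ : ∀ q → - 1ℤ - q + 1ℤ ≡ - q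
      lem₁ = solve-∀
    go : ∀ k → k ≡ n → ∑₂ (height v) (x + 1ℤ) k ≡ ∑₂ (height v) x k
    go zero _ = refl
    go (suc k) refl = trans (∑₂-last (height v) (x + 1ℤ) k) (trans (+-congˡ (∑₂ (height v) (x + 1ℤ) k)
      (∑-cong {λ i → height v i (x + 1ℤ + + k)} {height v x} (x + 1ℤ) k λ r r<k → trans (cong₂ (height v) (sym (+-suc-assoc x r)) (sym (+-suc-assoc x k)))
        (trans (swap-ends (suc r) (ℕ.s≤s ℕ.z≤n) (ℕ.s≤s r<k)) (cong (height v x) (+-suc-assoc x r)))))
      (ℤ.+-comm (∑₂ (height v) (x + 1ℤ) k) _))

  inversions-window : ∀ w x y → inversions w x ≡ inversions w y
  inversions-window w x y = trans (base x) (sym (base y))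
    where
    base : ∀ x → inversions w x ≡ inversions w 0ℤ
    base = ℤ-ind _ refl (λ x p → trans (inversions-suc w x) p) (λ x p → trans (sym (inversions-suc w x)) p)

  abstract
    -- The window at 0 is an arbitrary choice, justified by `inversions-window`. The definition is
    -- kept opaque, so that later arguments see only how the number behaves under `swap`.
    len : AffPerm n → ℕ
    len w = ∣ inversions w 0ℤ ∣

  abstract
    len-cong : ∀ {u w : AffPerm n} → (∀ i → inv u i ≡ inv w i) → len u ≡ len w
    len-cong eq = cong ∣_∣ (∑₂-cong 0ℤ n λ r r′ _ _ → cong₂ (λ a b → + ∣ (a - b) /ℕ n ∣) (eq _) (eq _))

  -- With the window placed at i, the exchanged positions come first: their rows of heights against
  -- all later positions trade places, and only the height of the pair (i, i + 1) itself changes, by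
  -- one.
  inversions-ascent : ∀ w i → inv w i < inv w (i + 1ℤ) → inversions (swap i w) i ≡ inversions w i + 1ℤ
  inversions-ascent w i asc = go n 2≤n refl
    where
    v = inv w
    v′ = inv (swap i w)
    at₀ : v′ i ≡ v (i + 1ℤ)
    at₀ = cong v (s-self i)
    at₁ : v′ (i + 1ℤ) ≡ v i
    at₁ = cong v (s-next i)
    lem : ∀ a b c d → a + 1ℤ + b + (c + d) ≡ a + c + (b + d) + 1ℤ
    lem = solve-∀
    go : ∀ k → 2 ℕ.≤ k → k ≡ n → ∑₂ (height v′) i k ≡ ∑₂ (height v) i k + 1ℤ
    go (suc zero) (ℕ.s≤s ()) _
    go (suc (suc k)) _ refl = trans
      (cong₂ _+_ (cong₂ _+_ front (row i (i + 1ℤ) at₀)) (cong₂ _+_ (row (i + 1ℤ) i at₁) rest))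
      (lem (height v i (i + 1ℤ)) (∑ (height v (i + 1ℤ)) (i + 1ℤ + 1ℤ) k) (∑ (height v i) (i + 1ℤ + 1ℤ) k) _)
      where
      far : ∀ r → r ℕ.< k → v′ (i + 1ℤ + 1ℤ + + r) ≡ v (i + 1ℤ + 1ℤ + + r)
      far r r<k = cong v (subst (λ y → s n i y ≡ y) (trans (+-suc-assoc i (suc r)) (+-suc-assoc (i + 1ℤ) r))
        (s-far i (suc (suc r)) (ℕ.s≤s (ℕ.s≤s ℕ.z≤n)) (ℕ.s≤s (ℕ.s≤s r<k))))
      front : height v′ i (i + 1ℤ) ≡ height v i (i + 1ℤ) + 1ℤ
      front = trans (cong₂ (λ a b → + ∣ (a - b) /ℕ n ∣) at₁ at₀)
        (height-swap (v i) (v (i + 1ℤ)) asc (distinct w i 1 (ℕ.s≤s ℕ.z≤n) 2≤n))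
      row : ∀ x y → v′ x ≡ v y → ∑ (height v′ x) (i + 1ℤ + 1ℤ) k ≡ ∑ (height v y) (i + 1ℤ + 1ℤ) k
      row x y eq = ∑-cong (i + 1ℤ + 1ℤ) k λ r r<k → cong₂ (λ a b → + ∣ (a - b) /ℕ n ∣) (far r r<k) eq
      rest : ∑₂ (height v′) (i + 1ℤ + 1ℤ) k ≡ ∑₂ (height v) (i + 1ℤ + 1ℤ) k
      rest = ∑₂-cong (i + 1ℤ + 1ℤ) k λ r r′ r<r′ r′<k →
        cong₂ (λ a b → + ∣ (a - b) /ℕ n ∣) (far r′ r′<k) (far r (ℕ.<-trans r<r′ r′<k))

  swap-swap : ∀ i w j → inv (swap i (swap i w)) j ≡ inv w j
  swap-swap i w j = cong (inv w) (s-involutive i j)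

  abstract
    len-ascent : ∀ w i → inv w i < inv w (i + 1ℤ) → len (swap i w) ≡ suc (len w)
    len-ascent w i asc = trans (cong ∣_∣ (trans (inversions-window (swap i w) 0ℤ i)
      (trans (inversions-ascent w i asc) (cong (_+ 1ℤ) (inversions-window w i 0ℤ)))))
      (suc-abs (∑₂-nonneg (height (inv w)) 0ℤ n λ _ _ → +≤+ ℕ.z≤n))
      where
      suc-abs : ∀ {x} → 0ℤ ≤ x → ∣ x + 1ℤ ∣ ≡ suc ∣ x ∣
      suc-abs {+ k} _ = ℕ.+-comm k 1

  len-descent : ∀ w i → inv w (i + 1ℤ) < inv w i → len w ≡ suc (len (swap i w))
  len-descent w i desc = trans (len-cong {w} {swap i (swap i w)} (λ j → sym (swap-swap i w j)))
    (len-ascent (swap i w) i (subst₂ _<_ (cong (inv w) (sym (s-self i))) (cong (inv w) (sym (s-next i))) desc))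

  len-swap-≤ : ∀ w i → len w ℕ.≤ suc (len (swap i w))
  len-swap-≤ w i with <-or-≥ (inv w (i + 1ℤ)) (inv w i)
  ... | inj₁ desc = ℕ.≤-reflexive (len-descent w i desc)
  ... | inj₂ ≥ = ℕ.m≤n⇒m≤1+n (ℕ.≤-trans (ℕ.n≤1+n _) (ℕ.≤-reflexive (sym (len-ascent w i
    (ℤ.≤∧≢⇒< ≥ λ eq → i≢i+1 i (inv-injective w eq))))))

  abstract
    len-id : ∀ w → (∀ i → inv w i ≡ i) → len w ≡ 0
    len-id w eq = cong ∣_∣ (trans (∑₂-cong {height (inv w)} {λ _ _ → 0ℤ} 0ℤ n zero-height) (∑₂-zero 0ℤ n))
      where
      lem : ∀ x y → 0ℤ + y - (0ℤ + x) ≡ y - x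
      lem = solve-∀
      zero-height : ∀ r r′ → r ℕ.< r′ → r′ ℕ.< n → height (inv w) (0ℤ + + r) (0ℤ + + r′) ≡ 0ℤ
      zero-height r r′ r<r′ r′<n = cong (λ q → + ∣ q ∣) (/ℕ-unique _ (r′ ℕ.∸ r) 0ℤ (ℕ.≤-<-trans (ℕ.m∸n≤m r′ r) r′<n)
        (trans (cong₂ _-_ (eq _) (eq _)) (trans (lem (+ r) (+ r′)) (trans (ℤ.m-n≡m⊖n r′ r)
          (trans (ℤ.⊖-≥ (ℕ.<⇒≤ r<r′)) (sym (ℤ.+-identityʳ _)))))))

  -- An increasing bijection of the integers takes steps of exactly one: the preimage of f i + 1
  -- lies at or beyond i + 1, so f (i + 1) ≤ f i + 1. Hence f is a translation, and the sum
  -- condition makes the translation trivial.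
  increasing⇒id : (w : AffPerm n) → (∀ i → fun w i < fun w (i + 1ℤ)) → ∀ i → fun w i ≡ i
  increasing⇒id w f< i = trans (const i) (trans (+-congˡ i c≡0) (ℤ.+-identityʳ i))
    where
    f = fun w
    c = f 0ℤ
    step : ∀ i → f (i + 1ℤ) ≡ f i + 1ℤ
    step i = ℤ.≤-antisym
      (subst (f (i + 1ℤ) ≤_) (fun-inv w _) (increasing-mono-≤ f f< (<⇒suc≤ (increasing-reflects f f<
        (subst (f i <_) (sym (fun-inv w _)) (≤⇒<suc ℤ.≤-refl))))))
      (<⇒suc≤ (f< i))
    lem : ∀ x c → x + 1ℤ + c ≡ x + c + 1ℤ
    lem = solve-∀
    const : ∀ i → f i ≡ i + c
    const = ℤ-ind _ (sym (ℤ.+-identityˡ c)) (λ x p → trans (step x) (trans (cong (_+ 1ℤ) p) (sym (lem x c))))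
      (λ x p → ℤ+.∙-cancelʳ 1ℤ _ _ (trans (sym (step x)) (trans p (lem x c))))
    lem₁ : ∀ i c → i + c - i ≡ c
    lem₁ = solve-∀
    c≡0 : c ≡ 0ℤ
    c≡0 with ℤ.i*j≡0⇒i≡0∨j≡0 N (trans (sym (∑-const c 0ℤ n))
             (trans (∑-cong-all 0ℤ n λ i → sym (trans (cong (_- i) (const i)) (lem₁ i c))) (excess≡0 w 0ℤ)))
    ... | inj₂ eq = eq
    ... | inj₁ eq = contradiction (ℤ.+-injective eq) (ℕ.>⇒≢ (ℕ.≤-trans (ℕ.s≤s ℕ.z≤n) 2≤n))

  -- Removing a descent lowers `len` by one and contributes one letter; once no descent is left, the
  -- inverse is increasing, hence the identity. The search starts at 1 because the generators are
  -- numbered 1 to n.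
  word-of-length : ∀ k (w : AffPerm n) → len w ≡ k →
    Σ (List (Fin n)) λ ws → length ws ≡ k × (∀ j → evalWord n (map genIndex ws) j ≡ fun w j)
  word-of-length k w len≡ with search (λ x → inv w (x + 1ℤ) <? inv w x) 1ℤ n
  word-of-length zero w len≡ | inj₁ (r , r<n , desc) = contradiction (trans (sym len≡) (len-descent w _ desc)) λ ()
  word-of-length (suc k) w len≡ | inj₁ (r , r<n , desc)
    with word-of-length k (swap (1ℤ + + r) w) (ℕ.suc-injective (trans (sym (len-descent w _ desc)) len≡))
  ... | ws , length≡ , eval = fromℕ< r<n ∷ ws , cong suc length≡ , λ j →
    trans (cong₂ (λ i x → s n (1ℤ + + i) x) (Fin.toℕ-fromℕ< r<n) (eval j)) (s-involutive (1ℤ + + r) (fun w j))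
  word-of-length k w len≡ | inj₂ ¬desc = [] , trans (sym (len-id w inv≡id)) len≡ , λ j →
    sym (trans (cong (fun w) (sym (inv≡id j))) (fun-inv w j))
    where
    increasing : ∀ x → inv w x < inv w (x + 1ℤ)
    increasing = periodic-ext {n} _
      (λ x lt → subst₂ _<_ (sym (inv-periodic w x)) (trans (sym (inv-periodic w (x + 1ℤ))) (cong (inv w) (lem x N)))
        (ℤ.+-monoˡ-< N lt))
      (λ x lt → +-cancelʳ-< N (subst₂ _<_ (inv-periodic w x) (trans (cong (inv w) (sym (lem x N))) (inv-periodic w (x + 1ℤ))) lt))
      1ℤ λ r r<n → ℤ.≤∧≢⇒< (ℤ.≮⇒≥ (¬desc r r<n)) λ eq → ℤ.<⇒≢ (≤⇒<suc ℤ.≤-refl) (inv-injective w eq)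
      where
      lem : ∀ x k → x + 1ℤ + k ≡ x + k + 1ℤ
      lem = solve-∀
    inv≡id : ∀ i → inv w i ≡ i
    inv≡id = increasing⇒id (w ⁻¹ₐ) increasing

  -- A single letter changes `len` by at most one.
  len-≤-word : ∀ (ws : List (Fin n)) w → (∀ j → evalWord n (map genIndex ws) j ≡ fun w j) → len w ℕ.≤ length ws
  len-≤-word [] w eval = ℕ.≤-reflexive (len-id w λ i → trans (eval (inv w i)) (fun-inv w i))
  len-≤-word (i ∷ ws) w eval = ℕ.≤-trans (len-swap-≤ w (+ genIndex i)) (ℕ.s≤s (len-≤-word ws (swap (+ genIndex i) w)
    λ j → trans (sym (s-involutive (+ genIndex i) _)) (cong (s n (+ genIndex i)) (eval j))))

  len-IsLength : ∀ w → IsLength w (len w)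
  len-IsLength w = word-of-length (len w) w refl , λ ws eval → len-≤-word ws w eval

  IsLength-unique : ∀ {w : AffPerm n} {k} → IsLength w k → k ≡ len w
  IsLength-unique {w} ((ws , refl , eval) , min) with word-of-length (len w) w refl
  ... | ws′ , length≡ , eval′ = ℕ.≤-antisym (subst (length ws ℕ.≤_) length≡ (min ws′ eval′)) (len-≤-word ws w eval)

-- A sum-of-squares potential and the positions of pairs

square : ℤ → ℤ
square x = x * x

square-nonneg : ∀ x → 0ℤ ≤ square x
square-nonneg (+ k) = *-nonneg {+ k} (+≤+ ℕ.z≤n) (+≤+ ℕ.z≤n)
square-nonneg -[1+ k ] = +≤+ ℕ.z≤n

-- Squared distance of f from the line of slope c over k positions. When c is the mean slope of f,
-- that is f (i + k) = f i + c k, the summand is periodic. Slope 1 is used for affine permutations,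
-- slope 2 for keys of pairs.
energy : ℤ → (ℤ → ℤ) → ℤ → ℕ → ℤ
energy c f x k = ∑ (λ i → square (f i - c * i)) x k

energy-nonneg : ∀ c f x k → 0ℤ ≤ energy c f x k
energy-nonneg c f x k = ∑-nonneg _ x k λ i → square-nonneg (f i - c * i)

energy-window : ∀ c f k → (∀ i → f (i + + k) ≡ f i + c * + k) → ∀ x y → energy c f x k ≡ energy c f y k
energy-window c f k per = ∑-window _ k λ i → cong square
  (trans (cong (_- c * (i + + k)) (per i)) (lem (f i) c i (+ k)))
  where
  lem : ∀ a c i k → a + c * k - c * (i + k) ≡ a - c * i
  lem = solve-∀

record Transposed (k : ℕ) (i : ℤ) (f g : ℤ → ℤ) : Set where
  field
    first : g i ≡ f (i + 1ℤ)
    second : g (i + 1ℤ) ≡ f i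
    others : ∀ r → 2 ℕ.≤ r → r ℕ.< k → g (i + + r) ≡ f (i + + r)

-- The squares of the two values and of their positions are unaffected; only the cross terms change,
-- by 2 c times the difference of the exchanged values.
energy-transposed : ∀ c f g k → 2 ℕ.≤ k → (∀ i → f (i + + k) ≡ f i + c * + k) → (∀ i → g (i + + k) ≡ g i + c * + k) →
  ∀ i → Transposed k i f g → ∀ x → energy c g x k + + 2 * c * (f i - f (i + 1ℤ)) ≡ energy c f x k
energy-transposed c f g (suc zero) (ℕ.s≤s ())
energy-transposed c f g (suc (suc k)) _ perf perg i t x =
  trans (cong (_+ + 2 * c * (f i - f (i + 1ℤ))) (trans (energy-window c g _ perg x i)
    (cong₂ _+_ (cong (λ a → square (a - c * i)) first)
      (cong₂ _+_ (cong (λ a → square (a - c * (i + 1ℤ))) second) rest))))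
  (trans (lem (f i) (f (i + 1ℤ)) c i (energy c f (i + 1ℤ + 1ℤ) k)) (energy-window c f _ perf i x))
  where
  open Transposed t
  rest : energy c g (i + 1ℤ + 1ℤ) k ≡ energy c f (i + 1ℤ + 1ℤ) k
  rest = ∑-cong (i + 1ℤ + 1ℤ) k λ r r<k → subst (λ y → square (g y - c * y) ≡ square (f y - c * y))
    (trans (+-suc-assoc i (suc r)) (+-suc-assoc (i + 1ℤ) r))
    (cong (λ a → square (a - c * (i + + suc (suc r)))) (others (suc (suc r)) (ℕ.s≤s (ℕ.s≤s ℕ.z≤n)) (ℕ.s≤s (ℕ.s≤s r<k))))
  lem : ∀ a b c i e → (b - c * i) * (b - c * i) + ((a - c * (i + 1ℤ)) * (a - c * (i + 1ℤ)) + e) + + 2 * c * (a - b)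
    ≡ (a - c * i) * (a - c * i) + ((b - c * (i + 1ℤ)) * (b - c * (i + 1ℤ)) + e)
  lem = solve-∀

left : ℤ → ℤ → ℤ
left e j = + 2 * j + e

left-suc : ∀ e j → left e (j + 1ℤ) ≡ left e j + + 2
left-suc = lem
  where
  lem : ∀ e j → + 2 * (j + 1ℤ) + e ≡ + 2 * j + e + + 2
  lem = solve-∀

parity : ∀ e x → ∃ λ j → x ≡ left e j ⊎ x ≡ left e j + 1ℤ
parity e x with (x - e) %ℕ 2 | n%ℕd<d (x - e) 2 | a≡a%ℕn+[a/ℕn]*n (x - e) 2
... | zero | _ | eq = (x - e) /ℕ 2 , inj₁ (lem x e ((x - e) /ℕ 2) eq)
  where
  lem′ : ∀ x e → x ≡ x - e + e
  lem′ = solve-∀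
  lem″ : ∀ q e → 0ℤ + q * + 2 + e ≡ + 2 * q + e
  lem″ = solve-∀
  lem : ∀ x e q → x - e ≡ 0ℤ + q * + 2 → x ≡ left e q
  lem x e q eq = trans (lem′ x e) (trans (cong (_+ e) eq) (lem″ q e))
... | suc zero | _ | eq = (x - e) /ℕ 2 , inj₂ (lem x e ((x - e) /ℕ 2) eq)
  where
  lem′ : ∀ x e → x ≡ x - e + e
  lem′ = solve-∀
  lem″ : ∀ q e → 1ℤ + q * + 2 + e ≡ + 2 * q + e + 1ℤ
  lem″ = solve-∀
  lem : ∀ x e q → x - e ≡ 1ℤ + q * + 2 → x ≡ left e q + 1ℤ
  lem x e q eq = trans (lem′ x e) (trans (cong (_+ e) eq) (lem″ q e))
... | suc (suc _) | ℕ.s≤s (ℕ.s≤s ()) | _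

-- Existence of a conjugating element

module Existence (n : ℕ) (2≤n : 2 ℕ.≤ n) where
  open Length n 2≤n public

  Pairs : AffPerm n → ℤ → AffPerm n → Set
  Pairs z e w = ∀ j → fun z (inv w (left e j)) ≡ inv w (left e j + 1ℤ)

  spread : AffPerm n → ℤ
  spread w = energy 1ℤ (inv w) 0ℤ n

  unit-quasi : ∀ (f : ℤ → ℤ) → Quasi f → ∀ i → f (i + N) ≡ f i + 1ℤ * N
  unit-quasi f per i = trans (per i) (+-congˡ (f i) (sym (ℤ.*-identityˡ N)))

  swap-transposed : ∀ w i → Transposed n i (inv w) (inv (swap i w))
  swap-transposed w i = record
    { first = cong (inv w) (s-self i)
    ; second = cong (inv w) (s-next i)
    ; others = λ r 2≤r r<n → cong (inv w) (s-far i r 2≤r r<n) }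

  spread-swap : ∀ w i → spread (swap i w) + + 2 * (inv w i - inv w (i + 1ℤ)) ≡ spread w
  spread-swap w i = energy-transposed 1ℤ (inv w) (inv (swap i w)) n 2≤n
    (unit-quasi (inv w) (inv-periodic w)) (unit-quasi (inv (swap i w)) (inv-periodic (swap i w))) i (swap-transposed w i) 0ℤ

  -- The sum of (w i - i)² can be reindexed by w. Thus `spread-swap`, which concerns one side of a
  -- permutation, also covers the other side, as conjugation requires.
  spread-inv : ∀ w → spread (w ⁻¹ₐ) ≡ spread w
  spread-inv w = trans (∑-cong-all 0ℤ n λ i → trans (lem (fun w i) i) (cong (λ y → square (y - 1ℤ * fun w i)) (sym (inv-fun w i))))
    (∑-permute w (λ x → square (inv w x - 1ℤ * x)) per 0ℤ)
    where
    lem : ∀ a i → (a - 1ℤ * i) * (a - 1ℤ * i) ≡ (i - 1ℤ * a) * (i - 1ℤ * a)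
    lem = solve-∀
    lem₁ : ∀ a i k → a + k - 1ℤ * (i + k) ≡ a - 1ℤ * i
    lem₁ = solve-∀
    per : ∀ i → square (inv w (i + N) - 1ℤ * (i + N)) ≡ square (inv w i - 1ℤ * i)
    per i = cong square (trans (cong (_- 1ℤ * (i + N)) (inv-periodic w i)) (lem₁ (inv w i) i N))

  -- `s n i` moves every point by at most one, so it can reverse the order of two points only when
  -- they are adjacent and form one of the exchanged pairs.
  s-mono : ∀ i {x y} → y < x → s n i y ≤ s n i x ⊎ (Multiple (y - i) × x ≡ y + 1ℤ)
  s-mono i {x} {y} y<x = go (s-view i y) (s-view i x)
    where
    x-1≤ : ∀ {x} → SView i x → x - 1ℤ ≤ s n i x
    x-1≤ {x} (hit₀ _ eq) = ≤-from (+ 2) (+≤+ ℕ.z≤n) (trans eq (solve (x ∷ [])))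
    x-1≤ {x} (hit₁ _ eq) = ℤ.≤-reflexive (sym eq)
    x-1≤ {x} (miss _ _ eq) = ≤-from 1ℤ (+≤+ ℕ.z≤n) (trans eq (solve (x ∷ [])))
    y-1≤y : ∀ y → y - 1ℤ ≤ y
    y-1≤y y = ≤-from 1ℤ (+≤+ ℕ.z≤n) (solve (y ∷ []))
    y≤x-1 : y ≤ x - 1ℤ
    y≤x-1 = ≤-from _ (gap< y<x) (solve (x ∷ y ∷ []))
    go : SView i y → SView i x → s n i y ≤ s n i x ⊎ (Multiple (y - i) × x ≡ y + 1ℤ)
    go (hit₁ _ eq) vx = inj₁ (ℤ.≤-trans (ℤ.≤-reflexive eq)
      (ℤ.≤-trans (y-1≤y y) (ℤ.≤-trans y≤x-1 (x-1≤ vx))))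
    go (miss _ _ eq) vx = inj₁ (ℤ.≤-trans (ℤ.≤-reflexive eq) (ℤ.≤-trans y≤x-1 (x-1≤ vx)))
    go (hit₀ _ eq) (hit₀ _ eq′) = inj₁ (subst₂ _≤_ (sym eq) (sym eq′) (ℤ.+-monoˡ-≤ 1ℤ (ℤ.<⇒≤ y<x)))
    go (hit₀ _ eq) (miss _ _ eq′) = inj₁ (subst₂ _≤_ (sym eq) (sym eq′) (<⇒suc≤ y<x))
    go (hit₀ m eq) (hit₁ _ eq′) with x ≟ y + 1ℤ
    ... | yes x≡ = inj₂ (m , x≡)
    ... | no x≢ = inj₁ (subst₂ _≤_ (sym eq) (sym eq′)
      (≤-from _ (gap< (ℤ.≤∧≢⇒< (<⇒suc≤ y<x) λ e → x≢ (sym e))) (solve (x ∷ y ∷ []))))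

  module _ (z : AffPerm n) (fpf : IsFPFInvolution z) where

    inv≡fun : ∀ i → inv z i ≡ fun z i
    inv≡fun i = trans (cong (inv z) (sym (proj₁ (fpf i)))) (inv-fun z (fun z i))

    conjugate : ℤ → AffPerm n
    conjugate i = gen i ∘ₐ z ∘ₐ gen i

    conjugate-fpf : ∀ i → IsFPFInvolution (conjugate i)
    conjugate-fpf i j =
      trans (cong (λ y → s n i (fun z y)) (s-involutive i _))
        (trans (cong (s n i) (proj₁ (fpf (s n i j)))) (s-involutive i j)) ,
      λ eq → proj₂ (fpf (s n i j)) (trans (sym (s-involutive i _)) (cong (s n i) eq))

    conjugate-pairs : ∀ i e w → Pairs (conjugate i) e w → Pairs z e (w ∘ₐ gen i)
    conjugate-pairs i e w pairs j = trans (sym (s-involutive i _)) (cong (s n i) (pairs j))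

    -- Multiplying by s_i on the right lowers the spread by twice z i - z (i + 1), which is
    -- positive; multiplying on the left then does not raise it, by `s-mono`.
    spread-conjugate : ∀ i → fun z (i + 1ℤ) < fun z i → fun z i ≢ i + 1ℤ → spread (conjugate i) < spread z
    spread-conjugate i desc ne with s-mono i desc
    -- In the exceptional case z (i + 1) = i + q n and z i = i + q n + 1. Applying z to the former
    -- gives i + 1 = i + 1 + 2 q n, so q = 0 and z i = i + 1, which is excluded.
    ... | inj₂ ((q , eq) , x≡) = contradiction x≡′ ne
      where
      lem : ∀ y i c → y - i ≡ c → y ≡ i + c
      lem y i _ refl = lem′ y i
        where
        lem′ : ∀ y i → y ≡ i + (y - i)
        lem′ = solve-∀
      lem₁ : ∀ i q k → i + q * k + 1ℤ + q * k ≡ i + 1ℤ + + 2 * q * k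
      lem₁ = solve-∀
      y≡ : fun z (i + 1ℤ) ≡ i + q * N
      y≡ = lem _ i _ eq
      double : i + 1ℤ + 0ℤ ≡ i + 1ℤ + + 2 * q * N
      double = trans (ℤ.+-identityʳ (i + 1ℤ)) (trans (sym (proj₁ (fpf (i + 1ℤ)))) (trans (cong (fun z) y≡) (trans (quasi-shift (fun z) (periodic z) i q)
        (trans (cong (_+ q * N) (trans x≡ (cong (_+ 1ℤ) y≡))) (lem₁ i q N)))))
      q≡0 : + 2 * q ≡ 0ℤ
      q≡0 with ℤ.i*j≡0⇒i≡0∨j≡0 (+ 2 * q) {N} (sym (ℤ+.∙-cancelˡ (i + 1ℤ) _ _ double))
      ... | inj₁ e = e
      ... | inj₂ e = contradiction (ℤ.+-injective e) (ℕ.>⇒≢ (ℕ.≤-trans (ℕ.s≤s ℕ.z≤n) 2≤n))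
      x≡′ : fun z i ≡ i + 1ℤ
      x≡′ with ℤ.i*j≡0⇒i≡0∨j≡0 (+ 2) q≡0
      ... | inj₂ refl = trans x≡ (cong (_+ 1ℤ) (trans y≡ (ℤ.+-identityʳ i)))
    ... | inj₁ mono = <-from _ (+-nonneg (+-nonneg (gap< desc) (gap (ℤ.<⇒≤ desc))) (*-nonneg {+ 2} (+≤+ ℕ.z≤n) (gap mono)))
        (trans (sym e₁) (trans (cong (λ a → a + + 2 * (x - y)) (sym e₂)) (lem (spread (conjugate i)) x y (s n i x) (s n i y))))
      where
      x = fun z i
      y = fun z (i + 1ℤ)
      u = z ∘ₐ gen i
      e₁ : spread u + + 2 * (x - y) ≡ spread z
      e₁ = trans (cong (λ a → a + + 2 * (x - y)) (sym (spread-inv u)))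
        (trans (spread-swap (z ⁻¹ₐ) i) (spread-inv z))
      e₂ : spread (conjugate i) + + 2 * (s n i x - s n i y) ≡ spread u
      e₂ = trans (cong₂ (λ a b → spread (conjugate i) + + 2 * (s n i a - s n i b)) (sym (inv≡fun i)) (sym (inv≡fun (i + 1ℤ))))
        (spread-swap u i)
      lem : ∀ m x y a b → m + + 2 * (a - b) + + 2 * (x - y) ≡ m + 1ℤ + (x - y - 1ℤ + (x - y) + + 2 * (a - b))
      lem = solve-∀

    Irreducible : Set
    Irreducible = ∀ i → fun z (i + 1ℤ) < fun z i → fun z i ≡ i + 1ℤ

    module _ (irr : Irreducible) where

      -- A descent at k would force z k = k + 1, so z keeps rising from k to k + 1 as long as z k >
      -- k + 1, and the strict gap persists.
      ascend : ∀ i → i + 1ℤ < fun z i → ∀ t → i + + t + 1ℤ < fun z (i + + t)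
      ascend i lt zero = subst (λ y → y + 1ℤ < fun z y) (sym (ℤ.+-identityʳ i)) lt
      ascend i lt (suc t) = subst (λ y → y + 1ℤ < fun z y) (trans (ℤ.+-assoc i (+ t) 1ℤ) (+-congˡ i (sym (+suc t))))
        (ℤ.≤-<-trans (<⇒suc≤ (ascend i lt t)) below)
        where
        k = i + + t
        below : fun z k < fun z (k + 1ℤ)
        below with <-or-≥ (fun z k) (fun z (k + 1ℤ))
        ... | inj₁ p = p
        ... | inj₂ p = contradiction (ascend i lt t) (ℤ.≤⇒≯ (ℤ.≤-reflexive (irr k (ℤ.≤∧≢⇒< p λ eq →
          ℤ.<⇒≢ (≤⇒<suc ℤ.≤-refl) (sym (fun-injective z eq))))))

      -- Were z i > i + 1, `ascend` could be followed up to the position z i, giving z (z i) > z i +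
      -- 1; but z (z i) = i lies below z i.
      up⇒suc : ∀ i → i < fun z i → fun z i ≡ i + 1ℤ
      up⇒suc i i<zi with i + 1ℤ <? fun z i
      ... | no ¬p = ℤ.≤-antisym (ℤ.≮⇒≥ ¬p) (<⇒suc≤ i<zi)
      ... | yes p with <⇒∃ i<zi
      ...   | t , eq = contradiction (subst (λ y → y + 1ℤ < fun z y) (sym eq) (ascend i p (suc t)))
        (ℤ.≤⇒≯ (subst (_≤ fun z i + 1ℤ) (sym (proj₁ (fpf i))) (ℤ.<⇒≤ (ℤ.<-trans i<zi (≤⇒<suc ℤ.≤-refl)))))

      neighbours : ∀ i → fun z i ≡ i + 1ℤ ⊎ fun z i + 1ℤ ≡ i
      neighbours i with ≢⇒<⊎> (proj₂ (fpf i))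
      ... | inj₂ i<zi = inj₁ (up⇒suc i i<zi)
      ... | inj₁ zi<i = inj₂ (trans (sym (up⇒suc (fun z i) (subst (fun z i <_) (sym (proj₁ (fpf i))) zi<i))) (proj₁ (fpf i)))

      a<a+2 : ∀ a → a < a + + 2
      a<a+2 a = <-from 1ℤ (+≤+ ℕ.z≤n) (solve (a ∷ []))

      alternate-up : ∀ a → fun z a ≡ a + 1ℤ → fun z (a + + 2) ≡ a + + 2 + 1ℤ
      alternate-up a eq with neighbours (a + + 2)
      ... | inj₁ p = p
      ... | inj₂ p = contradiction (trans (sym (proj₁ (fpf a))) (trans (cong (fun z) eq)
          (trans (cong (fun z) (sym (lem a _ p))) (proj₁ (fpf (a + + 2)))))) (ℤ.<⇒≢ (a<a+2 a))
        where
        lem : ∀ a x → x + 1ℤ ≡ a + + 2 → x ≡ a + 1ℤ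
        lem a x e = ℤ+.∙-cancelʳ 1ℤ _ _ (trans e (sym (ℤ.+-assoc a 1ℤ 1ℤ)))

      alternate-down : ∀ a → fun z (a + + 2) ≡ a + + 2 + 1ℤ → fun z a ≡ a + 1ℤ
      alternate-down a eq with neighbours (a + 1ℤ)
      ... | inj₁ p = contradiction (trans (sym (proj₁ (fpf (a + 1ℤ)))) (trans (cong (fun z) (trans p (ℤ.+-assoc a 1ℤ 1ℤ))) eq))
        (ℤ.<⇒≢ (ℤ.+-monoˡ-< 1ℤ (a<a+2 a)))
      ... | inj₂ p = trans (cong (fun z) (sym (ℤ+.∙-cancelʳ 1ℤ _ _ p))) (proj₁ (fpf (a + 1ℤ)))

      alternate : ∀ e → fun z e ≡ e + 1ℤ → ∀ j → fun z (left e j) ≡ left e j + 1ℤ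
      alternate e eq = ℤ-ind _ (subst (λ y → fun z y ≡ y + 1ℤ) (sym (ℤ.+-identityˡ e)) eq)
        (λ j p → subst (λ y → fun z y ≡ y + 1ℤ) (sym (left-suc e j)) (alternate-up (left e j) p))
        (λ j p → alternate-down (left e j) (subst (λ y → fun z y ≡ y + 1ℤ) (left-suc e j) p))

      -- The partner of 0 is 1 or -1, and this choice determines all other pairs. The identity then
      -- serves as the conjugating element.
      irreducible-pairs : (∀ j → fun z (left 0ℤ j) ≡ left 0ℤ j + 1ℤ) ⊎ (∀ j → fun z (left (- 1ℤ) j) ≡ left (- 1ℤ) j + 1ℤ)
      irreducible-pairs with neighbours 0ℤ
      ... | inj₁ p = inj₁ (alternate 0ℤ p)
      ... | inj₂ p = inj₂ (alternate (- 1ℤ) (trans (cong (fun z) (sym (ℤ+.∙-cancelʳ 1ℤ _ _ p))) (proj₁ (fpf 0ℤ))))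

  reducible? : ∀ (z : AffPerm n) i → Dec (fun z (i + 1ℤ) < fun z i × fun z i ≢ i + 1ℤ)
  reducible? z i with fun z (i + 1ℤ) <? fun z i | fun z i ≟ i + 1ℤ
  ... | no ¬p | _ = no λ (p , _) → ¬p p
  ... | yes p | yes q = no λ (_ , ¬q) → ¬q q
  ... | yes p | no ¬q = yes (p , ¬q)

  Parity : ℤ → Set
  Parity e = e ≡ 0ℤ ⊎ e ≡ - 1ℤ

  -- The recursion runs on a bound for the spread of z; the element found for s_i z s_i is carried
  -- back by composing with s_i.
  paired : ∀ k z → IsFPFInvolution z → ∣ spread z ∣ ℕ.< k → Σ ℤ λ e → Parity e × Σ (AffPerm n) λ w → Pairs z e w
  paired (suc k) z fpf (ℕ.s≤s bound) with search {λ i → fun z (i + 1ℤ) < fun z i × fun z i ≢ i + 1ℤ} (reducible? z) 0ℤ n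
  ... | inj₁ (r , _ , desc , ne)
      with paired k (conjugate z fpf (0ℤ + + r)) (conjugate-fpf z fpf (0ℤ + + r))
             (ℕ.<-≤-trans (∣∣-mono (energy-nonneg 1ℤ (inv (conjugate z fpf (0ℤ + + r))) 0ℤ n) (spread-conjugate z fpf (0ℤ + + r) desc ne)) bound)
  ...   | e , e∈ , w , pairs = e , e∈ , w ∘ₐ gen (0ℤ + + r) , conjugate-pairs z fpf (0ℤ + + r) e w pairs
  paired (suc k) z fpf _ | inj₂ none with irreducible-pairs z fpf irr
    where
    lem : ∀ x k → x + k + 1ℤ ≡ x + 1ℤ + k
    lem = solve-∀
    z-suc : ∀ x → fun z (x + N + 1ℤ) ≡ fun z (x + 1ℤ) + N
    z-suc x = trans (cong (fun z) (lem x N)) (periodic z (x + 1ℤ))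
    irr : Irreducible z fpf
    irr = periodic-ext {n} (λ i → fun z (i + 1ℤ) < fun z i → fun z i ≡ i + 1ℤ)
      (λ x h lt → trans (periodic z x) (trans (cong (_+ N) (h (+-cancelʳ-< N (subst₂ _<_ (z-suc x) (periodic z x) lt)))) (sym (lem x N))))
      (λ x h lt → ℤ+.∙-cancelʳ N _ _ (trans (sym (periodic z x))
        (trans (h (subst₂ _<_ (sym (z-suc x)) (sym (periodic z x)) (ℤ.+-monoˡ-< N lt))) (lem x N))))
      0ℤ λ r r<n lt → decide r r<n lt
      where
      decide : ∀ r → r ℕ.< n → fun z (0ℤ + + r + 1ℤ) < fun z (0ℤ + + r) → fun z (0ℤ + + r) ≡ 0ℤ + + r + 1ℤ
      decide r r<n lt with fun z (0ℤ + + r) ≟ 0ℤ + + r + 1ℤ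
      ... | yes eq = eq
      ... | no ne = contradiction (lt , ne) (none r r<n)
  ... | inj₁ p = 0ℤ , inj₁ refl , idₐ , p
  ... | inj₂ p = - 1ℤ , inj₂ refl , idₐ , p

  abstract
    pairs-exist : ∀ z → IsFPFInvolution z → Σ ℤ λ e → Parity e × Σ (AffPerm n) λ w → Pairs z e w
    pairs-exist z fpf = paired (suc ∣ spread z ∣) z fpf ℕ.≤-refl

-- The words of Θ⁺ and Θ⁻ as pairings of adjacent positions

progression : ℕ → ℕ → List ℕ
progression c zero = []
progression c (suc k) = c ∷ progression (2 ℕ.+ c) k

map-progression : ∀ (f : ℕ → ℕ) h c k → (∀ i → f (h i) ≡ c ℕ.+ 2 ℕ.* i) → map f (applyUpTo h k) ≡ progression c k
map-progression f h c zero eq = refl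
map-progression f h c (suc k) eq = cong₂ _∷_ (trans (eq 0) (ℕ.+-identityʳ c))
  (map-progression f (λ i → h (suc i)) (2 ℕ.+ c) k λ i → trans (eq (suc i))
    (trans (cong (c ℕ.+_) (ℕ.*-suc 2 i)) (trans (sym (ℕ.+-assoc c 2 (2 ℕ.* i))) (cong (ℕ._+ 2 ℕ.* i) (ℕ.+-comm c 2)))))

module Pairing (n : ℕ) (2≤n : 2 ℕ.≤ n) (l : ℕ) (n≡2l : n ≡ 2 ℕ.* l) where
  open Existence n 2≤n public

  N≡2l : N ≡ + 2 * + l
  N≡2l = trans (cong +_ n≡2l) (ℤ.pos-* 2 l)

  left-+l : ∀ e j → left e (j + + l) ≡ left e j + N
  left-+l e j = trans (lem e j (+ l)) (+-congˡ (left e j) (sym N≡2l))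
    where
    lem : ∀ e j l → + 2 * (j + l) + e ≡ + 2 * j + e + + 2 * l
    lem = solve-∀

  left-+ : ∀ e j r → left e (j + + r) ≡ left e j + + (2 ℕ.* r)
  left-+ e j r = trans (lem e j (+ r)) (+-congˡ (left e j) (sym (ℤ.pos-* 2 r)))
    where
    lem : ∀ e j l → + 2 * (j + l) + e ≡ + 2 * j + e + + 2 * l
    lem = solve-∀

  evalWord-quasi : ∀ ws → Quasi (evalWord n ws)
  evalWord-quasi [] x = refl
  evalWord-quasi (i ∷ ws) x = trans (cong (s n (+ i)) (evalWord-quasi ws x)) (s-quasi (+ i) _)

  2r+1<n : ∀ {r} → r ℕ.< l → suc (2 ℕ.* r) ℕ.< n
  2r+1<n {r} r<l = subst (suc (2 ℕ.* r) ℕ.<_) (sym n≡2l)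
    (ℕ.≤-trans (ℕ.≤-reflexive (sym (ℕ.*-suc 2 r))) (ℕ.*-monoʳ-≤ 2 r<l))

  IsPairing : ℤ → (ℤ → ℤ) → Set
  IsPairing e Θ = ∀ j → Θ (left e j) ≡ left e j + 1ℤ × Θ (left e j + 1ℤ) ≡ left e j

  -- δ and δ′ are 0 and 1 in either order: s c exchanges c + δ and c + δ′ for every c.
  module Slot (δ δ′ : ℕ) (δ≤1 : δ ℕ.≤ 1) (δ′≤1 : δ′ ℕ.≤ 1) (s-δ : ∀ i → s n i (i + + δ) ≡ i + + δ′) where

    at : ℕ → ℕ → ℕ → ℤ
    at c t δ = + (c ℕ.+ (2 ℕ.* t ℕ.+ δ))

    at-suc : ∀ c t δ → at c (suc t) δ ≡ at (2 ℕ.+ c) t δ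
    at-suc c t δ = cong +_ (trans (cong (λ y → c ℕ.+ (y ℕ.+ δ)) (ℕ.*-suc 2 t))
      (trans (sym (ℕ.+-assoc c 2 _)) (cong (ℕ._+ (2 ℕ.* t ℕ.+ δ)) (ℕ.+-comm c 2))))

    s-at-zero : ∀ c → s n (+ c) (at c 0 δ) ≡ at c 0 δ′
    s-at-zero c = trans (cong (s n (+ c)) (ℤ.pos-+ c δ)) (trans (s-δ (+ c)) (sym (ℤ.pos-+ c δ′)))

    s-at-suc : ∀ c t δ → δ ℕ.≤ 1 → suc t ℕ.< l → s n (+ c) (at c (suc t) δ) ≡ at c (suc t) δ
    s-at-suc c t δ δ≤1 t<l = s-far (+ c) (2 ℕ.* suc t ℕ.+ δ)
      (ℕ.≤-trans (ℕ.≤-trans (ℕ.m≤m+n 2 (2 ℕ.* t)) (ℕ.≤-reflexive (sym (ℕ.*-suc 2 t)))) (ℕ.m≤m+n _ δ))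
      (ℕ.≤-<-trans (ℕ.≤-trans (ℕ.+-monoʳ-≤ (2 ℕ.* suc t) δ≤1) (ℕ.≤-reflexive (ℕ.+-comm _ 1))) (2r+1<n t<l))

    -- The letters c, c + 2, ... up to c + 2 (k - 1) act on the slots before k; since t < l, slot t
    -- is not reached from the other side around the period either.
    outside : ∀ k c t → k ℕ.≤ t → t ℕ.< l → evalWord n (progression c k) (at c t δ) ≡ at c t δ
    outside zero c t _ _ = refl
    outside (suc k) c (suc t) (ℕ.s≤s k≤t) t<l = trans
      (cong (s n (+ c)) (trans (cong (evalWord n (progression (2 ℕ.+ c) k)) (at-suc c t δ))
        (trans (outside k (2 ℕ.+ c) t k≤t (ℕ.<-trans (ℕ.n<1+n t) t<l)) (sym (at-suc c t δ)))))
      (s-at-suc c t δ δ≤1 t<l)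

    inside : ∀ k c t → t ℕ.< k → k ℕ.≤ l → evalWord n (progression c k) (at c t δ) ≡ at c t δ′
    inside (suc k) c (suc t) (ℕ.s≤s t<k) k<l = trans
      (cong (s n (+ c)) (trans (cong (evalWord n (progression (2 ℕ.+ c) k)) (at-suc c t δ))
        (trans (inside k (2 ℕ.+ c) t t<k (ℕ.<⇒≤ k<l)) (sym (at-suc c t δ′)))))
      (s-at-suc c t δ′ δ′≤1 (ℕ.<-≤-trans (ℕ.s≤s t<k) k<l))
    -- The letters after the first must fix the initial slot, which lies before all of them. Shifted
    -- by n it becomes slot l - 1 of the progression starting at c + 2, where `outside` applies.
    inside (suc k) c zero _ k<l = trans (cong (s n (+ c)) (ℤ+.∙-cancelʳ N _ _
      (trans (sym (evalWord-quasi (progression (2 ℕ.+ c) k) (at c 0 δ)))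
        (trans (cong (evalWord n (progression (2 ℕ.+ c) k)) wrap)
          (trans (outside k (2 ℕ.+ c) (ℕ.pred l) (ℕ.≤-pred (ℕ.≤-trans k<l (ℕ.≤-reflexive (sym suc-pred)))) (ℕ.≤-reflexive suc-pred)) (sym wrap)))))) (s-at-zero c)
      where
      suc-pred : suc (ℕ.pred l) ≡ l
      suc-pred = ℕ.suc-pred l {{ℕ.>-nonZero (ℕ.≤-<-trans ℕ.z≤n k<l)}}
      wrap : at c 0 δ + N ≡ at (2 ℕ.+ c) (ℕ.pred l) δ
      wrap = trans (trans (sym (ℤ.pos-+ (c ℕ.+ δ) n)) (cong +_ (trans (ℕ.+-assoc c δ n) (cong (c ℕ.+_) (trans (ℕ.+-comm δ n) (cong (ℕ._+ δ) (trans n≡2l (cong (2 ℕ.*_) (sym suc-pred)))))))))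
        (at-suc c (ℕ.pred l) δ)

  module Slot₀ = Slot 0 1 ℕ.z≤n ℕ.≤-refl (λ i → trans (cong (s n i) (ℤ.+-identityʳ i)) (s-self i))
  module Slot₁ = Slot 1 0 ℕ.≤-refl ℕ.z≤n (λ i → trans (s-next i) (sym (ℤ.+-identityʳ i)))

  l>0 : 0 ℕ.< l
  l>0 = ℕ.n≢0⇒n>0 λ { refl → contradiction (subst (2 ℕ.≤_) n≡2l 2≤n) λ () }

  instance
    l-nonZero : ℕ.NonZero l
    l-nonZero = ℕ.>-nonZero l>0

  -- The first letter c acts at `left e 1ℤ`, which is 2 + e. The check therefore starts at j = 1,
  -- with c = 1 for e = -1 and c = 2 for e = 0.
  progression-pairing : ∀ c e → + c ≡ + 2 + e → IsPairing e (evalWord n (progression c l))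
  progression-pairing c e c≡ = periodic-ext {l} _ (λ j → up j) (λ j → down j) 1ℤ base
    where
    E = evalWord n (progression c l)
    lem : ∀ a k → a + k + 1ℤ ≡ a + 1ℤ + k
    lem = solve-∀
    E-left : ∀ j → E (left e (j + + l)) ≡ E (left e j) + N
    E-left j = trans (cong E (left-+l e j)) (evalWord-quasi (progression c l) (left e j))
    left-suc-+l : ∀ j → left e (j + + l) + 1ℤ ≡ left e j + 1ℤ + N
    left-suc-+l j = trans (cong (_+ 1ℤ) (left-+l e j)) (lem (left e j) N)
    E-right : ∀ j → E (left e (j + + l) + 1ℤ) ≡ E (left e j + 1ℤ) + N
    E-right j = trans (cong E (left-suc-+l j)) (evalWord-quasi (progression c l) (left e j + 1ℤ))
    Swaps : ℤ → Set
    Swaps j = E (left e j) ≡ left e j + 1ℤ × E (left e j + 1ℤ) ≡ left e j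
    up : ∀ j → Swaps j → Swaps (j + + l)
    up j (p , q) = trans (E-left j) (trans (cong (_+ N) p) (sym (left-suc-+l j))) ,
      trans (E-right j) (trans (cong (_+ N) q) (sym (left-+l e j)))
    down : ∀ j → Swaps (j + + l) → Swaps j
    down j (p , q) = ℤ+.∙-cancelʳ N _ _ (trans (sym (E-left j)) (trans p (left-suc-+l j))) ,
      ℤ+.∙-cancelʳ N _ _ (trans (sym (E-right j)) (trans q (left-+l e j)))
    lem₁ : ∀ e r → + 2 * (1ℤ + r) + e ≡ + 2 + e + + 2 * r
    lem₁ = solve-∀
    position : ∀ r → left e (1ℤ + + r) ≡ + (c ℕ.+ 2 ℕ.* r)
    position r = trans (lem₁ e (+ r)) (trans (cong₂ _+_ (sym c≡) (sym (ℤ.pos-* 2 r))) (sym (ℤ.pos-+ c (2 ℕ.* r))))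
    position₀ : ∀ r → left e (1ℤ + + r) ≡ + (c ℕ.+ (2 ℕ.* r ℕ.+ 0))
    position₀ r = trans (position r) (cong (λ y → + (c ℕ.+ y)) (sym (ℕ.+-identityʳ (2 ℕ.* r))))
    position₁ : ∀ r → left e (1ℤ + + r) + 1ℤ ≡ + (c ℕ.+ (2 ℕ.* r ℕ.+ 1))
    position₁ r = trans (cong (_+ 1ℤ) (position r)) (trans (sym (ℤ.pos-+ (c ℕ.+ 2 ℕ.* r) 1)) (cong +_ (ℕ.+-assoc c (2 ℕ.* r) 1)))
    base : ∀ r → r ℕ.< l → Swaps (1ℤ + + r)
    base r r<l = trans (cong E (position₀ r)) (trans (Slot₀.inside l c r r<l ℕ.≤-refl) (sym (position₁ r))) ,
      trans (cong E (position₁ r)) (trans (Slot₁.inside l c r r<l ℕ.≤-refl) (sym (position₀ r)))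

  n/2≡l : n ℕ./ 2 ≡ l
  n/2≡l = trans (cong (ℕ._/ 2) (trans n≡2l (ℕ.*-comm 2 l))) (m*n/n≡m l 2)

  Θ⁺-pairing : IsPairing (- 1ℤ) (Θ⁺ n)
  Θ⁺-pairing = subst (λ ws → IsPairing (- 1ℤ) (evalWord n ws))
    (sym (trans (cong (λ k → map (λ j → suc (2 ℕ.* j)) (upTo k)) n/2≡l) (map-progression _ _ 1 l λ _ → refl)))
    (progression-pairing 1 (- 1ℤ) refl)

  Θ⁻-pairing : IsPairing 0ℤ (Θ⁻ n)
  Θ⁻-pairing = subst (λ ws → IsPairing 0ℤ (evalWord n ws))
    (sym (trans (cong (λ k → map (λ j → 2 ℕ.+ 2 ℕ.* j) (upTo k)) n/2≡l) (map-progression _ _ 2 l λ _ → refl)))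
    (progression-pairing 2 0ℤ refl)

  conj⇒pairs : ∀ {z w : AffPerm n} {e Θ} → IsPairing e Θ → ConjBy Θ w z → Pairs z e w
  conj⇒pairs {z} {w} {e} {Θ} pairing conj j = trans (sym (conj (inv w (left e j))))
    (cong (inv w) (trans (cong Θ (fun-inv w (left e j))) (proj₁ (pairing j))))

  pairs⇒conj : ∀ {z w : AffPerm n} {e Θ} → IsFPFInvolution z → IsPairing e Θ → Pairs z e w → ConjBy Θ w z
  pairs⇒conj {z} {w} {e} {Θ} fpf pairing pairs i = trans (at (fun w i) (parity e (fun w i))) (cong (fun z) (inv-fun w i))
    where
    at : ∀ x → (∃ λ j → x ≡ left e j ⊎ x ≡ left e j + 1ℤ) → inv w (Θ x) ≡ fun z (inv w x)
    at x (j , inj₁ refl) = trans (cong (inv w) (proj₁ (pairing j))) (sym (pairs j))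
    at x (j , inj₂ refl) = trans (cong (inv w) (proj₂ (pairing j)))
      (trans (sym (proj₁ (fpf (inv w (left e j))))) (cong (fun z) (pairs j)))

-- Exchanging adjacent pairs of positions

data Side : Set where
  lower upper : Side

module Sorting (n : ℕ) (2≤n : 2 ℕ.≤ n) (l : ℕ) (n≡2l : n ≡ 2 ℕ.* l) where
  open Pairing n 2≤n l n≡2l public

  s-on : ∀ t a → s n (t + + a) (t + + a) ≡ t + + suc a
  s-on t a = trans (s-self (t + + a)) (trans (ℤ.+-assoc t (+ a) 1ℤ) (+-congˡ t (sym (+suc a))))

  s-on-suc : ∀ t a → s n (t + + a) (t + + suc a) ≡ t + + a
  s-on-suc t a = trans (cong (s n (t + + a)) (trans (+-congˡ t (+suc a)) (sym (ℤ.+-assoc t (+ a) 1ℤ)))) (s-next (t + + a))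

  s-off : ∀ t a b → suc a ℕ.< n → b ℕ.< n → b ≢ a → b ≢ suc a → s n (t + + a) (t + + b) ≡ t + + b
  s-off t a b a<n b<n b≢a b≢a+1 = s-miss (t + + a) (t + + b)
    (λ (q , eq) → apart a (ℕ.<-trans (ℕ.n<1+n a) a<n) b≢a q (trans (sym (lem t (+ a) (+ b))) eq))
    (λ (q , eq) → apart (suc a) a<n b≢a+1 q (trans (trans (+-congˡ (+ b) (cong -_ (+suc a))) (sym (lem₁ t (+ a) (+ b)))) eq))
    where
    lem : ∀ t a b → t + b - (t + a) ≡ b - a
    lem = solve-∀
    lem₁ : ∀ t a b → t + b - (t + a + 1ℤ) ≡ b - (a + 1ℤ)
    lem₁ = solve-∀
    lem₂ : ∀ a b → b ≡ a + (b - a)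
    lem₂ = solve-∀
    apart : ∀ a → a ℕ.< n → b ≢ a → ∀ q → + b - + a ≢ q * N
    apart a a<n b≢a q eq = b≢a (ℤ.+-injective (trans b≡ (trans (+-congˡ (+ a) (cong (_* N) (residue-unique b a q b<n a<n b≡)))
      (ℤ.+-identityʳ (+ a)))))
      where
      b≡ : + b ≡ + a + q * N
      b≡ = trans (lem₂ (+ a) (+ b)) (+-congˡ (+ a) eq)

  2≤l⇒4≤n : 2 ℕ.≤ l → 4 ℕ.≤ n
  2≤l⇒4≤n 2≤l = subst (4 ℕ.≤_) (sym n≡2l) (ℕ.*-monoʳ-≤ 2 2≤l)

  record PairSwapped (t : ℤ) (u w : AffPerm n) : Set where
    field
      at₀ : inv w (t + + 0) ≡ inv u (t + + 2)
      at₁ : inv w (t + + 1) ≡ inv u (t + + 3)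
      at₂ : inv w (t + + 2) ≡ inv u (t + + 0)
      at₃ : inv w (t + + 3) ≡ inv u (t + + 1)
      others : ∀ r → 4 ℕ.≤ r → r ℕ.< n → inv w (t + + r) ≡ inv u (t + + r)

  PairSwapped-sym : ∀ {t u w} → PairSwapped t u w → PairSwapped t w u
  PairSwapped-sym p = record { at₀ = sym at₂ ; at₁ = sym at₃ ; at₂ = sym at₀ ; at₃ = sym at₁ ; others = λ r h h′ → sym (others r h h′) }
    where open PairSwapped p

  module PairSwap (t : ℤ) (4≤n : 4 ℕ.≤ n) (u : AffPerm n) where
    val : AffPerm n → ℕ → ℤ
    val w r = inv w (t + + r)

    -- The block exchange in four adjacent exchanges: p q p′ q′, p p′ q q′, p′ p q q′, p′ p q′ q, p′
    -- q′ p q.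
    w₁ w₂ w₃ w₄ : AffPerm n
    w₁ = swap (t + + 1) u
    w₂ = swap (t + + 0) w₁
    w₃ = swap (t + + 2) w₂
    w₄ = swap (t + + 1) w₃

    off : ∀ w a b → suc a ℕ.< n → b ℕ.< n → b ≢ a → b ≢ suc a → val (swap (t + + a) w) b ≡ val w b
    off w a b h₁ h₂ h₃ h₄ = cong (inv w) (s-off t a b h₁ h₂ h₃ h₄)
    on : ∀ w a → val (swap (t + + a) w) a ≡ val w (suc a)
    on w a = cong (inv w) (s-on t a)
    on-suc : ∀ w a → val (swap (t + + a) w) (suc a) ≡ val w a
    on-suc w a = cong (inv w) (s-on-suc t a)

    1<n : 1 ℕ.< n
    1<n = 2≤n
    2<n : 2 ℕ.< n
    2<n = ℕ.≤-trans (ℕ.n≤1+n 3) 4≤n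
    0<n : 0 ℕ.< n
    0<n = ℕ.<-trans ℕ.z<s 1<n

    far : ∀ w a r → a ℕ.≤ 2 → 4 ℕ.≤ r → r ℕ.< n → val (swap (t + + a) w) r ≡ val w r
    far w a r a≤2 4≤r r<n = off w a r (ℕ.≤-trans (ℕ.s≤s (ℕ.s≤s a≤2)) 4≤n) r<n
      (ℕ.>⇒≢ (ℕ.≤-trans (ℕ.s≤s a≤2) (ℕ.≤-trans (ℕ.n≤1+n 3) 4≤r))) (ℕ.>⇒≢ (ℕ.≤-trans (ℕ.s≤s (ℕ.s≤s a≤2)) 4≤r))

    w₂-at₀ : val w₂ 0 ≡ val u 2
    w₂-at₀ = trans (on w₁ 0) (on u 1)
    w₂-at₁ : val w₂ 1 ≡ val u 0
    w₂-at₁ = trans (on-suc w₁ 0) (off u 1 0 2<n 0<n (λ ()) (λ ()))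
    w₂-at₂ : val w₂ 2 ≡ val u 1
    w₂-at₂ = trans (off w₁ 0 2 1<n 2<n (λ ()) (λ ())) (on-suc u 1)
    w₂-at₃ : val w₂ 3 ≡ val u 3
    w₂-at₃ = trans (off w₁ 0 3 1<n 4≤n (λ ()) (λ ())) (off u 1 3 2<n 4≤n (λ ()) (λ ()))
    w₃-at₁ : val w₃ 1 ≡ val u 0
    w₃-at₁ = trans (off w₂ 2 1 4≤n 1<n (λ ()) (λ ())) w₂-at₁
    w₃-at₂ : val w₃ 2 ≡ val u 3
    w₃-at₂ = trans (on w₂ 2) w₂-at₃

    swapped : PairSwapped t u w₄
    swapped = record
      { at₀ = trans (off w₃ 1 0 2<n 0<n (λ ()) (λ ())) (trans (off w₂ 2 0 4≤n 0<n (λ ()) (λ ())) w₂-at₀)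
      ; at₁ = trans (on w₃ 1) w₃-at₂
      ; at₂ = trans (on-suc w₃ 1) w₃-at₁
      ; at₃ = trans (off w₃ 1 3 2<n 4≤n (λ ()) (λ ())) (trans (on-suc w₂ 2) w₂-at₂)
      ; others = λ r 4≤r r<n → trans (far w₃ 1 r (ℕ.s≤s ℕ.z≤n) 4≤r r<n) (trans (far w₂ 2 r ℕ.≤-refl 4≤r r<n)
          (trans (far w₁ 0 r ℕ.z≤n 4≤r r<n) (far u 1 r (ℕ.s≤s ℕ.z≤n) 4≤r r<n))) }

    t+suc : ∀ a → t + + suc a ≡ t + + a + 1ℤ
    t+suc a = trans (+-congˡ t (+suc a)) (sym (ℤ.+-assoc t (+ a) 1ℤ))

    down : ∀ w a → val w (suc a) < val w a → len w ≡ suc (len (swap (t + + a) w))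
    down w a lt = len-descent w (t + + a) (subst (λ y → inv w y < val w a) (t+suc a) lt)

    up : ∀ w a → val w a < val w (suc a) → len (swap (t + + a) w) ≡ suc (len w)
    up w a lt = len-ascent w (t + + a) (subst (λ y → val w a < inv w y) (t+suc a) lt)

    module _ (p01 : val u 0 < val u 1) (p23 : val u 2 < val u 3) where

      second : val w₁ 0 ≡ val u 0 × val w₁ 1 ≡ val u 2
      second = off u 1 0 2<n 0<n (λ ()) (λ ()) , on u 1

      -- The first three exchanges are descents, because p′ < p < q and q′ < q. The last one costs
      -- at most one, whatever the order of p and q′, so the total still drops.
      noncrossing-shorter : val u 2 < val u 0 → val u 3 < val u 1 → len w₄ ℕ.< len u
      noncrossing-shorter p20 p31 = subst (len w₄ ℕ.<_) (sym (trans (down u 1 (ℤ.<-trans p20 p01)) (cong suc (trans (down w₁ 0 (subst₂ _<_ (sym (proj₂ second)) (sym (proj₁ second)) p20))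
        (cong suc (down w₂ 2 (subst₂ _<_ (sym w₂-at₃) (sym w₂-at₂) p31)))))))
        (ℕ.s≤s (ℕ.≤-trans last (ℕ.n≤1+n _)))
        where
        last : len w₄ ℕ.≤ suc (len w₃)
        last = subst (λ k → len w₄ ℕ.≤ suc k) (len-cong {swap (t + + 1) w₄} {w₃} (swap-swap (t + + 1) w₃)) (len-swap-≤ w₄ (t + + 1))

      last-up : val u 0 < val u 3 → len w₄ ≡ suc (len w₃)
      last-up p03 = up w₃ 1 (subst₂ _<_ (sym w₃-at₁) (sym w₃-at₂) p03)

      -- For p′ < p < q < q′ the first two exchanges are descents and the last two are ascents.
      inner-first-length : val u 2 < val u 0 → val u 1 < val u 3 → len w₄ ≡ len u
      inner-first-length p20 p13 = trans (last-up (ℤ.<-trans p01 p13)) (trans (cong suc (up w₂ 2 (subst₂ _<_ (sym w₂-at₂) (sym w₂-at₃) p13)))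
        (sym (trans (down u 1 (ℤ.<-trans p20 p01)) (cong suc (down w₁ 0 (subst₂ _<_ (sym (proj₂ second)) (sym (proj₁ second)) p20))))))

      -- For p < p′ < q′ < q descents and ascents alternate.
      outer-first-length : val u 0 < val u 2 → val u 3 < val u 1 → len w₄ ≡ len u
      outer-first-length p02 p31 = trans (last-up (ℤ.<-trans p02 p23)) (trans (sym (down w₂ 2 (subst₂ _<_ (sym w₂-at₃) (sym w₂-at₂) p31)))
        (trans (up w₁ 0 (subst₂ _<_ (sym (proj₁ second)) (sym (proj₂ second)) p02)) (sym (down u 1 (ℤ.<-trans p23 p31)))))

  record PairSwapResult (t : ℤ) (u : AffPerm n) : Set where
    field
      result : AffPerm n
      swapped : PairSwapped t u result
      noncrossing : inv u (t + + 2) < inv u (t + + 0) → inv u (t + + 3) < inv u (t + + 1) → len result ℕ.< len u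
      inner-first : inv u (t + + 2) < inv u (t + + 0) → inv u (t + + 1) < inv u (t + + 3) → len result ≡ len u
      outer-first : inv u (t + + 0) < inv u (t + + 2) → inv u (t + + 3) < inv u (t + + 1) → len result ≡ len u

  abstract
    swap-adjacent-pairs : ∀ t → 4 ℕ.≤ n → ∀ u → inv u (t + + 0) < inv u (t + + 1) → inv u (t + + 2) < inv u (t + + 3) → PairSwapResult t u
    swap-adjacent-pairs t 4≤n u p01 p23 = record
      { result = w₄ ; swapped = swapped ; noncrossing = noncrossing-shorter p01 p23
      ; inner-first = inner-first-length p01 p23 ; outer-first = outer-first-length p01 p23 }
      where open PairSwap t 4≤n u

  nested⇒≺₀ : ∀ {t u w} → PairSwapped t u w → inv u (t + + 0) < inv u (t + + 2) → inv u (t + + 2) < inv u (t + + 3) →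
    inv u (t + + 3) < inv u (t + + 1) → u ≺₀ w
  -- The windows of `≺₀` begin at m + 1, hence m = t - 1; its entries a, d, b, c are p, q, p′, q′.
  nested⇒≺₀ {t} {u} {w} p p02 p23 p31 = t - 1ℤ , _ , _ , _ , _ , p02 , p23 , p31 ,
    (eq u 0 , eq u 1 , eq u 2 , eq u 3) ,
    (trans (eq w 0) at₀ , trans (eq w 1) at₁ , trans (eq w 2) at₂ , trans (eq w 3) at₃) ,
    λ { (suc r) (ℕ.s≤s 4≤r) r<n → trans (eq u r) (trans (sym (others r 4≤r r<n)) (sym (eq w r))) }
    where
    open PairSwapped p
    lem : ∀ t → t - 1ℤ + 1ℤ ≡ t
    lem = solve-∀
    eq : ∀ (x : AffPerm n) r → inv x (t - 1ℤ + + suc r) ≡ inv x (t + + r)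
    eq x r = cong (inv x) (trans (+-suc-assoc (t - 1ℤ) r) (cong (_+ + r) (lem t)))

  nested⇒≻₀ : ∀ {t u w} → PairSwapped t u w → inv u (t + + 2) < inv u (t + + 0) → inv u (t + + 0) < inv u (t + + 1) →
    inv u (t + + 1) < inv u (t + + 3) → w ≺₀ u
  nested⇒≻₀ {t} {u} {w} p p20 p01 p13 = nested⇒≺₀ {t} {w} {u} (PairSwapped-sym p)
    (subst₂ _<_ (sym at₀) (sym at₂) p20) (subst₂ _<_ (sym at₂) (sym at₃) p01) (subst₂ _<_ (sym at₃) (sym at₁) p13)
    where open PairSwapped p

  ≺₀⇒PairSwapped : ∀ {u w : AffPerm n} ((m , _) : u ≺₀ w) → PairSwapped (m + 1ℤ) u w
  ≺₀⇒PairSwapped {u} {w} (m , a , b , c , d , _ , _ , _ , (u₁ , u₂ , u₃ , u₄) , (w₁ , w₂ , w₃ , w₄) , rest) = record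
    { at₀ = trans (eq w 0) (trans w₁ (sym (trans (eq u 2) u₃)))
    ; at₁ = trans (eq w 1) (trans w₂ (sym (trans (eq u 3) u₄)))
    ; at₂ = trans (eq w 2) (trans w₃ (sym (trans (eq u 0) u₁)))
    ; at₃ = trans (eq w 3) (trans w₄ (sym (trans (eq u 1) u₂)))
    ; others = λ r 4≤r r<n → trans (eq w r) (trans (sym (rest (suc r) (ℕ.s≤s 4≤r) r<n)) (sym (eq u r))) }
    where
    eq : ∀ (x : AffPerm n) r → inv x (m + 1ℤ + + r) ≡ inv x (m + + suc r)
    eq x r = cong (inv x) (sym (+-suc-assoc m r))

  module _ (e : ℤ) where

    pairs-ext : (Q : ℤ → ℤ → Set) → (∀ {a b} → Q a b → Q (a + N) (b + N)) → (∀ {a b} → Q (a + N) (b + N) → Q a b) →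
      ∀ (w : AffPerm n) j → (∀ r → r ℕ.< l → Q (inv w (left e j + + (2 ℕ.* r))) (inv w (left e j + + suc (2 ℕ.* r)))) →
      ∀ i → Q (inv w (left e i)) (inv w (left e i + 1ℤ))
    pairs-ext Q up down w j base = periodic-ext {l} _
      (λ i q → subst₂ Q (sym (eq₀ i)) (sym (eq₁ i)) (up q)) (λ i q → down (subst₂ Q (eq₀ i) (eq₁ i) q)) j
      λ r r<l → subst₂ Q (cong (inv w) (sym (left-+ e j r))) (cong (inv w) (eq₂ r)) (base r r<l)
      where
      lem : ∀ a k → a + k + 1ℤ ≡ a + 1ℤ + k
      lem = solve-∀
      eq₀ : ∀ i → inv w (left e (i + + l)) ≡ inv w (left e i) + N
      eq₀ i = trans (cong (inv w) (left-+l e i)) (inv-periodic w (left e i))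
      eq₁ : ∀ i → inv w (left e (i + + l) + 1ℤ) ≡ inv w (left e i + 1ℤ) + N
      eq₁ i = trans (cong (inv w) (trans (cong (_+ 1ℤ) (left-+l e i)) (lem (left e i) N))) (inv-periodic w (left e i + 1ℤ))
      eq₂ : ∀ r → left e j + + suc (2 ℕ.* r) ≡ left e (j + + r) + 1ℤ
      eq₂ r = trans (+-congˡ (left e j) (+suc (2 ℕ.* r))) (trans (sym (ℤ.+-assoc (left e j) _ 1ℤ)) (cong (_+ 1ℤ) (sym (left-+ e j r))))

    PairwiseRelated : (ℤ → ℤ → Set) → AffPerm n → Set
    PairwiseRelated Q w = ∀ i → Q (inv w (left e i)) (inv w (left e i + 1ℤ))

    pair-at : ∀ {Q w} → PairwiseRelated Q w → ∀ j → Q (inv w (left e j + + 0)) (inv w (left e j + + 1))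
    pair-at {Q} {w} h j = subst (λ y → Q (inv w y) (inv w (left e j + 1ℤ))) (sym (ℤ.+-identityʳ (left e j))) (h j)

    pair-at-suc : ∀ {Q w} → PairwiseRelated Q w → ∀ j → Q (inv w (left e j + + 2)) (inv w (left e j + + 3))
    pair-at-suc {Q} {w} h j = subst₂ (λ y y′ → Q (inv w y) (inv w y′)) (left-suc e j)
      (trans (cong (_+ 1ℤ) (left-suc e j)) (ℤ.+-assoc (left e j) (+ 2) 1ℤ)) (h (j + 1ℤ))

    pair-at-+ : ∀ {Q w} → PairwiseRelated Q w → ∀ j r → Q (inv w (left e j + + (2 ℕ.* r))) (inv w (left e j + + suc (2 ℕ.* r)))
    pair-at-+ {Q} {w} h j r = subst₂ (λ y y′ → Q (inv w y) (inv w y′)) (left-+ e j r)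
      (trans (cong (_+ 1ℤ) (left-+ e j r)) (trans (ℤ.+-assoc (left e j) _ 1ℤ) (+-congˡ (left e j) (sym (+suc (2 ℕ.* r))))))
      (h (j + + r))

    -- Pairs move as whole blocks, so any translation-invariant relation between the two ends of
    -- each pair survives. It is applied both to being a cycle of z and to being in rising order.
    PairSwapped-preserves : (Q : ℤ → ℤ → Set) → (∀ {a b} → Q a b → Q (a + N) (b + N)) → (∀ {a b} → Q (a + N) (b + N) → Q a b) →
      ∀ {j u w} → PairSwapped (left e j) u w → PairwiseRelated Q u → PairwiseRelated Q w
    PairSwapped-preserves Q up down {j} {u} {w} p h = pairs-ext Q up down w j base
      where
      open PairSwapped p
      base : ∀ r → r ℕ.< l → Q (inv w (left e j + + (2 ℕ.* r))) (inv w (left e j + + suc (2 ℕ.* r)))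
      base 0 _ = subst₂ Q (sym at₀) (sym at₁) (pair-at-suc {Q} {u} h j)
      base 1 _ = subst₂ Q (sym at₂) (sym at₃) (pair-at {Q} {u} h j)
      base (suc (suc r)) r<l = subst₂ Q (sym (others _ 4≤ (ℕ.<-trans (ℕ.n<1+n _) (2r+1<n r<l))))
        (sym (others _ (ℕ.m≤n⇒m≤1+n 4≤) (2r+1<n r<l))) (pair-at-+ {Q} {u} h j (suc (suc r)))
        where
        4≤ : 4 ℕ.≤ 2 ℕ.* suc (suc r)
        4≤ = ℕ.*-monoʳ-≤ 2 (ℕ.s≤s (ℕ.s≤s (ℕ.z≤n {r})))

    Rising : AffPerm n → Set
    Rising = PairwiseRelated _<_

    key : Side → AffPerm n → ℤ → ℤ
    key lower w j = inv w (left e j)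
    key upper w j = inv w (left e j + 1ℤ)

    key-periodic : ∀ o w j → key o w (j + + l) ≡ key o w j + N
    key-periodic lower w j = trans (cong (inv w) (left-+l e j)) (inv-periodic w (left e j))
    key-periodic upper w j = trans (cong (inv w) (trans (cong (_+ 1ℤ) (left-+l e j)) (lem (left e j) N))) (inv-periodic w (left e j + 1ℤ))
      where
      lem : ∀ a k → a + k + 1ℤ ≡ a + 1ℤ + k
      lem = solve-∀

    Sorted : Side → AffPerm n → Set
    Sorted o w = ∀ j → key o w j < key o w (j + 1ℤ)

    disorder : Side → AffPerm n → ℤ
    disorder o w = energy (+ 2) (key o w) 0ℤ l

    PairSwapped-transposed : ∀ o {j u w} → PairSwapped (left e j) u w → Transposed l j (key o u) (key o w)
    PairSwapped-transposed lower {j} {u} {w} p = record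
      { first = trans (cong (inv w) (sym (ℤ.+-identityʳ (left e j)))) (trans at₀ (cong (inv u) (sym (left-suc e j))))
      ; second = trans (cong (inv w) (left-suc e j)) (trans at₂ (cong (inv u) (ℤ.+-identityʳ (left e j))))
      ; others = λ r 2≤r r<l → trans (cong (inv w) (left-+ e j r)) (trans
          (others (2 ℕ.* r) (ℕ.*-monoʳ-≤ 2 2≤r) (ℕ.<-trans (ℕ.n<1+n _) (2r+1<n r<l))) (cong (inv u) (sym (left-+ e j r)))) }
      where open PairSwapped p
    PairSwapped-transposed upper {j} {u} {w} p = record
      { first = trans at₁ (cong (inv u) (sym suc+1))
      ; second = trans (cong (inv w) suc+1) at₃
      ; others = λ r 2≤r r<l → trans (cong (inv w) (eq r)) (trans
          (others (suc (2 ℕ.* r)) (ℕ.m≤n⇒m≤1+n (ℕ.*-monoʳ-≤ 2 2≤r)) (2r+1<n r<l)) (cong (inv u) (sym (eq r)))) }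
      where
      open PairSwapped p
      suc+1 : left e (j + 1ℤ) + 1ℤ ≡ left e j + + 3
      suc+1 = trans (cong (_+ 1ℤ) (left-suc e j)) (ℤ.+-assoc (left e j) (+ 2) 1ℤ)
      eq : ∀ r → left e (j + + r) + 1ℤ ≡ left e j + + suc (2 ℕ.* r)
      eq r = trans (cong (_+ 1ℤ) (left-+ e j r)) (trans (ℤ.+-assoc (left e j) _ 1ℤ) (+-congˡ (left e j) (sym (+suc (2 ℕ.* r)))))

    -- The drop is 4 times the difference of the two keys, by `energy-transposed` with slope 2.
    disorder-drop : ∀ o {j u w} → 2 ℕ.≤ l → PairSwapped (left e j) u w → key o u (j + 1ℤ) < key o u j → disorder o w < disorder o u
    disorder-drop o {j} {u} {w} 2≤l p lt = <-from _ (+-nonneg (*-nonneg {+ 4} (+≤+ ℕ.z≤n) (gap< lt)) (+≤+ (ℕ.z≤n {3})))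
      (trans (sym (energy-transposed (+ 2) (key o u) (key o w) l 2≤l (per u) (per w) j (PairSwapped-transposed o p) 0ℤ))
        (lem (disorder o w) (key o u j) (key o u (j + 1ℤ))))
      where
      per : ∀ x i → key o x (i + + l) ≡ key o x i + + 2 * + l
      per x i = trans (key-periodic o x i) (+-congˡ (key o x i) N≡2l)
      lem : ∀ m x y → m + + 2 * + 2 * (x - y) ≡ m + 1ℤ + (+ 4 * (x - y - 1ℤ) + + 3)
      lem = solve-∀

    -- For l = 1 the next key is the present one shifted by n, so it cannot be smaller. This
    -- supplies the four distinct residues that a block exchange needs.
    descent⇒2≤l : ∀ o w j → key o w (j + 1ℤ) < key o w j → 2 ℕ.≤ l
    descent⇒2≤l o w j lt with ℕ.m≤n⇒m<n∨m≡n l>0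
    ... | inj₁ p = p
    ... | inj₂ 1≡l = contradiction lt (ℤ.≤⇒≯ (≤-from N (+≤+ ℕ.z≤n) (trans (cong (λ k → key o w (j + + k)) 1≡l) (key-periodic o w j))))

    key-injective : ∀ o w {i j} → key o w i ≡ key o w j → i ≡ j
    key-injective o w {i} {j} eq = ℤ.*-cancelˡ-≡ (+ 2) i j (ℤ+.∙-cancelʳ e _ _ (cancel o eq))
      where
      cancel : ∀ o → key o w i ≡ key o w j → left e i ≡ left e j
      cancel lower eq = inv-injective w eq
      cancel upper eq = ℤ+.∙-cancelʳ 1ℤ _ _ (inv-injective w eq)


  ≺₀-respˡ : ∀ {u u′ w : AffPerm n} → u ≈ u′ → u′ ≺₀ w → u ≺₀ w
  ≺₀-respˡ {u} {u′} u≈ (m , a , b , c , d , ab , bc , cd , (u₁ , u₂ , u₃ , u₄) , ws , rest) =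
    m , a , b , c , d , ab , bc , cd , (trans (eq _) u₁ , trans (eq _) u₂ , trans (eq _) u₃ , trans (eq _) u₄) , ws ,
    λ j h h′ → trans (eq _) (rest j h h′)
    where
    eq : ∀ i → inv u i ≡ inv u′ i
    eq = ≈⇒inv {u} {u′} u≈

  ≺₀-respʳ : ∀ {u w w′ : AffPerm n} → w ≈ w′ → u ≺₀ w → u ≺₀ w′
  ≺₀-respʳ {u} {w} {w′} w≈ (m , a , b , c , d , ab , bc , cd , us , (w₁ , w₂ , w₃ , w₄) , rest) =
    m , a , b , c , d , ab , bc , cd , us , (trans (eq _) w₁ , trans (eq _) w₂ , trans (eq _) w₃ , trans (eq _) w₄) ,
    λ j h h′ → trans (rest j h h′) (sym (eq _))
    where
    eq : ∀ i → inv w′ i ≡ inv w i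
    eq i = sym (≈⇒inv {w} {w′} w≈ i)

  ≺-respˡ : ∀ {u u′ w : AffPerm n} → u ≈ u′ → u′ ≺ w → u ≺ w
  ≺-respˡ {u} {u′} u≈ ([_]⁺ {y = y} p) = [ ≺₀-respˡ {u} {u′} {y} u≈ p ]⁺
  ≺-respˡ {u} {u′} u≈ (_∷⁺_ {y = y} p ps) = ≺₀-respˡ {u} {u′} {y} u≈ p ∷⁺ ps

  ≺-respʳ : ∀ {u w w′ : AffPerm n} → w ≈ w′ → u ≺ w → u ≺ w′
  ≺-respʳ {u} {w} {w′} w≈ [ p ]⁺ = [ ≺₀-respʳ {u} {w} {w′} w≈ p ]⁺
  ≺-respʳ {u} {w} {w′} w≈ (p ∷⁺ ps) = p ∷⁺ ≺-respʳ {w = w} {w′} w≈ ps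

-- Sorting the pairs, extremal elements and atoms

module Atoms (n : ℕ) (2≤n : 2 ℕ.≤ n) (l : ℕ) (n≡2l : n ≡ 2 ℕ.* l) where
  open Sorting n 2≤n l n≡2l public

  -- Restoring the order of the smaller ends of nested pairs puts the outer pair first, which is a
  -- step down; restoring that of the larger ends puts the inner pair first, a step up.
  Step : Side → AffPerm n → AffPerm n → Set
  Step lower w u = w ≺₀ u
  Step upper w u = u ≺₀ w

  Chain : Side → AffPerm n → AffPerm n → Set
  Chain lower w u = w ≈ u ⊎ w ≺ u
  Chain upper w u = w ≈ u ⊎ u ≺ w

  chain-step : ∀ o {w v u : AffPerm n} → Chain o w v → Step o v u → Chain o w u
  chain-step lower {w} {v} {u} (inj₁ w≈v) v≺u = inj₂ [ ≺₀-respˡ {w} {v} {u} w≈v v≺u ]⁺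
  chain-step lower (inj₂ w≺v) v≺u = inj₂ (w≺v ++⁺ [ v≺u ]⁺)
  chain-step upper {w} {v} {u} (inj₁ w≈v) u≺v = inj₂ [ ≺₀-respʳ {u} {v} {w} (λ i → sym (w≈v i)) u≺v ]⁺
  chain-step upper (inj₂ v≺w) u≺v = inj₂ (u≺v ∷⁺ v≺w)

  chain-resp : ∀ o {w w′ u : AffPerm n} → w ≈ w′ → Chain o w′ u → Chain o w u
  chain-resp lower w≈ (inj₁ p) = inj₁ λ i → trans (w≈ i) (p i)
  chain-resp lower {w} {w′} w≈ (inj₂ p) = inj₂ (≺-respˡ {w} {w′} w≈ p)
  chain-resp upper w≈ (inj₁ p) = inj₁ λ i → trans (w≈ i) (p i)
  chain-resp upper {w} {w′} w≈ (inj₂ p) = inj₂ (≺-respʳ {w = w′} {w} (λ i → sym (w≈ i)) p)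

  module _ (e : ℤ) where

    val : AffPerm n → ℤ → ℕ → ℤ
    val w j r = inv w (left e j + + r)

    lower-val : ∀ w j → key e lower w j ≡ val w j 0
    lower-val w j = cong (inv w) (sym (ℤ.+-identityʳ (left e j)))

    lower-val-suc : ∀ w j → key e lower w (j + 1ℤ) ≡ val w j 2
    lower-val-suc w j = cong (inv w) (left-suc e j)

    upper-val-suc : ∀ w j → key e upper w (j + 1ℤ) ≡ val w j 3
    upper-val-suc w j = cong (inv w) (trans (cong (_+ 1ℤ) (left-suc e j)) (ℤ.+-assoc (left e j) (+ 2) 1ℤ))

    -- The two keys are out of order, so the comparison of the other ends decides: also out of order
    -- means a shorter element, in order means nested pairs and a step of equal length.
    pair-swap : ∀ o u j → Rising e u → key e o u (j + 1ℤ) < key e o u j →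
      Σ (AffPerm n) λ w → PairSwapped (left e j) u w × (len w ℕ.< len u ⊎ len w ≡ len u × Step o w u)
    pair-swap o u j rising lt = result , swapped , compare o lt
      where
      p01 : val u j 0 < val u j 1
      p01 = pair-at e {_<_} {u} rising j
      p23 : val u j 2 < val u j 3
      p23 = pair-at-suc e {_<_} {u} rising j
      open PairSwapResult (swap-adjacent-pairs (left e j) (2≤l⇒4≤n (descent⇒2≤l e o u j lt)) u p01 p23)
      2≢0 : val u j 2 ≢ val u j 0
      2≢0 eq = i≢i+1 j (key-injective e lower u (trans (lower-val u j) (trans (sym eq) (sym (lower-val-suc u j)))))
      3≢1 : val u j 3 ≢ val u j 1
      3≢1 eq = i≢i+1 j (key-injective e upper u (trans (sym eq) (sym (upper-val-suc u j))))
      compare : ∀ o → key e o u (j + 1ℤ) < key e o u j → len result ℕ.< len u ⊎ len result ≡ len u × Step o result u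
      compare lower lt = [_,_]′
        (λ p31 → inj₁ (noncrossing p20 p31))
        (λ p13 → inj₂ (inner-first p20 p13 , nested⇒≻₀ {left e j} {u} {result} swapped p20 p01 p13))
        (≢⇒<⊎> 3≢1)
        where
        p20 : val u j 2 < val u j 0
        p20 = subst₂ _<_ (lower-val-suc u j) (lower-val u j) lt
      compare upper lt = [_,_]′
        (λ p20 → inj₁ (noncrossing p20 p31))
        (λ p02 → inj₂ (outer-first p02 p31 , nested⇒≺₀ {left e j} {u} {result} swapped p02 p23 p31))
        (≢⇒<⊎> 2≢0)
        where
        p31 : val u j 3 < val u j 1
        p31 = subst (_< val u j 1) (upper-val-suc u j) lt

  module Involution (z : AffPerm n) (fpf : IsFPFInvolution z) where

    Pairs-preserved : ∀ {e j u w} → PairSwapped (left e j) u w → Pairs z e u → Pairs z e w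
    Pairs-preserved {e} {j} = PairSwapped-preserves e (λ a b → fun z a ≡ b)
      (λ {a} p → trans (periodic z a) (cong (_+ N) p))
      (λ {a} p → ℤ+.∙-cancelʳ N _ _ (trans (sym (periodic z a)) p)) {j}

    Rising-preserved : ∀ {e j u w} → PairSwapped (left e j) u w → Rising e u → Rising e w
    Rising-preserved {e} {j} = PairSwapped-preserves e _<_ (λ p → ℤ.+-monoˡ-< N p) (λ p → +-cancelʳ-< N p) {j}

    -- A chain is promised only when the length ends up unchanged: then no exchange on the way can
    -- have shortened the element, so all of them were between nested pairs. The bound k on the
    -- disorder drives the recursion.
    sort-below : ∀ o e k u → ∣ disorder e o u ∣ ℕ.< k → Pairs z e u → Rising e u →
      Σ (AffPerm n) λ w → Pairs z e w × Rising e w × Sorted e o w × len w ℕ.≤ len u × (len w ≡ len u → Chain o w u)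
    sort-below o e (suc k) u (ℕ.s≤s bound) pairs rising = [_,_]′ exchange settled
      (search (λ j → key e o u (j + 1ℤ) <? key e o u j) 0ℤ l)
      where
      Falls : ℤ → Set
      Falls j = key e o u (j + 1ℤ) < key e o u j
      Goal : Set
      Goal = Σ (AffPerm n) λ w → Pairs z e w × Rising e w × Sorted e o w × len w ℕ.≤ len u × (len w ≡ len u → Chain o w u)
      settled : (∀ r → r ℕ.< l → ¬ Falls (0ℤ + + r)) → Goal
      settled none = u , pairs , rising , sorted , ℕ.≤-refl , λ _ → reflexive o
        where
        reflexive : ∀ o → Chain o u u
        reflexive lower = inj₁ λ _ → refl
        reflexive upper = inj₁ λ _ → refl
        lem : ∀ j k → j + k + 1ℤ ≡ j + 1ℤ + k
        lem = solve-∀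
        key-suc : ∀ j → key e o u (j + + l + 1ℤ) ≡ key e o u (j + 1ℤ) + N
        key-suc j = trans (cong (key e o u) (lem j (+ l))) (key-periodic e o u (j + 1ℤ))
        sorted : Sorted e o u
        sorted = periodic-ext {l} (λ j → key e o u j < key e o u (j + 1ℤ))
          (λ j lt → subst₂ _<_ (sym (key-periodic e o u j)) (sym (key-suc j)) (ℤ.+-monoˡ-< N lt))
          (λ j lt → +-cancelʳ-< N (subst₂ _<_ (key-periodic e o u j) (key-suc j) lt))
          0ℤ λ r r<l → ℤ.≤∧≢⇒< (ℤ.≮⇒≥ (none r r<l)) λ eq → i≢i+1 (0ℤ + + r) (key-injective e o u eq)
      exchange : (∃ λ r → r ℕ.< l × Falls (0ℤ + + r)) → Goal
      exchange (r , _ , lt) = extend (pair-swap e o u j rising lt)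
        where
        j = 0ℤ + + r
        extend : (Σ (AffPerm n) λ v → PairSwapped (left e j) u v × (len v ℕ.< len u ⊎ len v ≡ len u × Step o v u)) → Goal
        extend (v , swapped , outcome) = combine (sort-below o e k v
            (ℕ.<-≤-trans (∣∣-mono (energy-nonneg (+ 2) (key e o v) 0ℤ l)
              (disorder-drop e o {j} (descent⇒2≤l e o u j lt) swapped lt)) bound)
            (Pairs-preserved {e} {j} swapped pairs) (Rising-preserved {e} {j} swapped rising))
          where
          combine : (Σ (AffPerm n) λ w → Pairs z e w × Rising e w × Sorted e o w × len w ℕ.≤ len v × (len w ≡ len v → Chain o w v)) → Goal
          combine (w , pairs′ , rising′ , sorted , w≤v , chain) = w , pairs′ , rising′ , sorted , w≤u outcome , chain′ outcome
            where
            w≤u : len v ℕ.< len u ⊎ len v ≡ len u × Step o v u → len w ℕ.≤ len u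
            w≤u (inj₁ v<u) = ℕ.≤-trans w≤v (ℕ.<⇒≤ v<u)
            w≤u (inj₂ (v≡u , _)) = subst (len w ℕ.≤_) v≡u w≤v
            chain′ : len v ℕ.< len u ⊎ len v ≡ len u × Step o v u → len w ≡ len u → Chain o w u
            chain′ (inj₁ v<u) w≡u = contradiction (subst (ℕ._≤ len v) w≡u w≤v) (ℕ.<⇒≱ v<u)
            chain′ (inj₂ (v≡u , step)) w≡u = chain-step o {w} {v} {u} (chain (trans w≡u (sym v≡u))) step

    abstract
      sort : ∀ o {e} u → Pairs z e u → Rising e u →
        Σ (AffPerm n) λ w → Pairs z e w × Rising e w × Sorted e o w × len w ℕ.≤ len u × (len w ≡ len u → Chain o w u)
      sort o {e} u = sort-below o e (suc ∣ disorder e o u ∣) u ℕ.≤-refl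

    -- Turning a pair around exchanges the two points of a cycle, and an involution maps each of
    -- them to the other.
    swap-pairs : ∀ e u j → Pairs z e u → Pairs z e (swap (left e j) u)
    swap-pairs e u j pairs = pairs-ext e (λ a b → fun z a ≡ b)
      (λ {a} p → trans (periodic z a) (cong (_+ N) p))
      (λ {a} p → ℤ+.∙-cancelʳ N _ _ (trans (sym (periodic z a)) p)) (swap (left e j) u) j base
      where
      t = left e j
      w = swap t u
      base : ∀ r → r ℕ.< l → fun z (inv w (t + + (2 ℕ.* r))) ≡ inv w (t + + suc (2 ℕ.* r))
      base zero _ = trans (cong (λ y → fun z (inv w y)) (ℤ.+-identityʳ t))
        (trans (cong (λ y → fun z (inv u y)) (s-self t))
        (trans (cong (fun z) (sym (pairs j))) (trans (proj₁ (fpf (inv u t))) (cong (inv u) (sym (s-next t))))))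
      base (suc r) r<l = subst₂ (λ a b → fun z a ≡ b)
        (cong (inv u) (sym (s-far t (2 ℕ.* suc r) 2≤ (ℕ.<-trans (ℕ.n<1+n _) (2r+1<n r<l)))))
        (cong (inv u) (sym (s-far t (suc (2 ℕ.* suc r)) (ℕ.m≤n⇒m≤1+n 2≤) (2r+1<n r<l))))
        (pair-at-+ e {λ a b → fun z a ≡ b} {u} pairs j (suc r))
        where
        2≤ : 2 ℕ.≤ 2 ℕ.* suc r
        2≤ = ℕ.*-monoʳ-≤ 2 (ℕ.s≤s (ℕ.z≤n {r}))

    -- A falling pair is a descent, so turning it lowers the length, which therefore bounds the
    -- recursion.
    raise-below : ∀ e k u → len u ℕ.< k → Pairs z e u → Σ (AffPerm n) λ w → Pairs z e w × Rising e w × len w ℕ.≤ len u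
    raise-below e (suc k) u (ℕ.s≤s bound) pairs = [_,_]′ lowered settled
      (search (λ j → inv u (left e j + 1ℤ) <? inv u (left e j)) 0ℤ l)
      where
      Falls : ℤ → Set
      Falls j = inv u (left e j + 1ℤ) < inv u (left e j)
      lowered : (∃ λ r → r ℕ.< l × Falls (0ℤ + + r)) → Σ (AffPerm n) λ w → Pairs z e w × Rising e w × len w ℕ.≤ len u
      lowered (r , _ , lt) = w , pairs′ , rising , ℕ.≤-trans le (ℕ.≤-trans (ℕ.n≤1+n _) (ℕ.≤-reflexive (sym shorter)))
        where
        t = left e (0ℤ + + r)
        shorter : len u ≡ suc (len (swap t u))
        shorter = len-descent u t lt
        IH : Σ (AffPerm n) λ w → Pairs z e w × Rising e w × len w ℕ.≤ len (swap t u)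
        IH = raise-below e k (swap t u) (ℕ.<-≤-trans (ℕ.≤-reflexive (sym shorter)) bound) (swap-pairs e u (0ℤ + + r) pairs)
        w = proj₁ IH
        pairs′ = proj₁ (proj₂ IH)
        rising = proj₁ (proj₂ (proj₂ IH))
        le = proj₂ (proj₂ (proj₂ IH))
      settled : (∀ r → r ℕ.< l → ¬ Falls (0ℤ + + r)) → Σ (AffPerm n) λ w → Pairs z e w × Rising e w × len w ℕ.≤ len u
      settled none = u , pairs , rising , ℕ.≤-refl
        where
        rising : Rising e u
        rising = pairs-ext e _<_ (λ p → ℤ.+-monoˡ-< N p) (λ p → +-cancelʳ-< N p) u 0ℤ λ r r<l →
          subst₂ (λ a b → inv u a < inv u b) (left-+ e 0ℤ r)
            (trans (cong (_+ 1ℤ) (left-+ e 0ℤ r)) (trans (ℤ.+-assoc (left e 0ℤ) _ 1ℤ) (+-congˡ (left e 0ℤ) (sym (+suc (2 ℕ.* r))))))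
            (ℤ.≤∧≢⇒< (ℤ.≮⇒≥ (none r r<l)) λ eq → i≢i+1 (left e (0ℤ + + r)) (inv-injective u eq))

    abstract
      raise : ∀ {e} u → Pairs z e u → Σ (AffPerm n) λ w → Pairs z e w × Rising e w × len w ℕ.≤ len u
      raise {e} u = raise-below e (suc (len u)) u ℕ.≤-refl

    module _ e w (pairs : Pairs z e w) (rising : Rising e w) where

      partner : ∀ j → fun z (inv w (left e j + 1ℤ)) ≡ inv w (left e j)
      partner j = trans (cong (fun z) (sym (pairs j))) (proj₁ (fpf (inv w (left e j))))

      -- On a right position sits the larger point of a cycle, whose partner is smaller.
      left-endpoint : ∀ a → a < fun z a → ∃ λ j → fun w a ≡ left e j
      left-endpoint a a<za with parity e (fun w a)
      ... | j , inj₁ eq = j , eq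
      ... | j , inj₂ eq = contradiction a<za (ℤ.<-asym (subst₂ _<_ (trans (sym (partner j)) (cong (fun z) a≡)) a≡ (rising j)))
        where
        a≡ : inv w (left e j + 1ℤ) ≡ a
        a≡ = trans (cong (inv w) (sym eq)) (inv-fun w a)

      right-endpoint : ∀ d → fun z d < d → ∃ λ j → fun w d ≡ left e j + 1ℤ
      right-endpoint d zd<d with parity e (fun w d)
      ... | j , inj₂ eq = j , eq
      ... | j , inj₁ eq = contradiction zd<d (ℤ.<-asym (subst₂ _<_ d≡ (trans (sym (pairs j)) (cong (fun z) d≡)) (rising j)))
        where
        d≡ : inv w (left e j) ≡ d
        d≡ = trans (cong (inv w) (sym eq)) (inv-fun w d)

      left<partner : ∀ j → inv w (left e j) < fun z (inv w (left e j))
      left<partner j = subst (inv w (left e j) <_) (sym (pairs j)) (rising j)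

    -- u ∘ w⁻¹ carries pairs of adjacent positions to pairs of adjacent positions and is
    -- increasing on them, so it is an increasing affine permutation, i.e. the identity.
    sorted-unique : ∀ o {e e′ w u} → Pairs z e w → Rising e w → Sorted e o w → Pairs z e′ u → Rising e′ u → Sorted e′ o u → w ≈ u
    sorted-unique o {e} {e′} {w} {u} pw rw sw pu ru su i =
      trans (sym (σ≡id (fun w i))) (cong (fun u) (inv-fun w i))
      where
      σ : AffPerm n
      σ = u ∘ₐ (w ⁻¹ₐ)
      τ : ∀ j → ∃ λ j′ → fun σ (left e j) ≡ left e′ j′
      τ j = left-endpoint e′ u pu ru (inv w (left e j)) (left<partner e w pw rw j)
      inv-σ : ∀ {x y} → fun σ x ≡ y → inv w x ≡ inv u y
      inv-σ {x} {y} eq = trans (sym (inv-fun u (inv w x))) (cong (inv u) eq)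
      σ-right : ∀ j → fun σ (left e j + 1ℤ) ≡ left e′ (proj₁ (τ j)) + 1ℤ
      σ-right j = trans (cong (fun u) (trans (sym (pw j)) (trans (cong (fun z) (inv-σ (proj₂ (τ j)))) (pu (proj₁ (τ j)))))) (fun-inv u (left e′ (proj₁ (τ j)) + 1ℤ))
      key-τ : ∀ o j → key e o w j ≡ key e′ o u (proj₁ (τ j))
      key-τ lower j = inv-σ (proj₂ (τ j))
      key-τ upper j = inv-σ (σ-right j)
      τ-mono : ∀ j → proj₁ (τ j) < proj₁ (τ (j + 1ℤ))
      τ-mono j = increasing-reflects (key e′ o u) su (subst₂ _<_ (key-τ o j) (key-τ o (j + 1ℤ)) (sw j))
      σ-increasing : ∀ x → fun σ x < fun σ (x + 1ℤ)
      σ-increasing x with parity e x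
      ... | j , inj₁ refl = subst₂ _<_ (sym (proj₂ (τ j))) (sym (σ-right j)) (≤⇒<suc ℤ.≤-refl)
      ... | j , inj₂ refl = subst₂ _<_ (sym (σ-right j))
        (trans (sym (proj₂ (τ (j + 1ℤ)))) (cong (fun σ) (trans (left-suc e j) (sym (ℤ.+-assoc (left e j) 1ℤ 1ℤ)))))
        (<-from _ (*-nonneg {+ 2} (+≤+ ℕ.z≤n) (gap< (τ-mono j))) (lem e′ (proj₁ (τ j)) (proj₁ (τ (j + 1ℤ)))))
        where
        lem : ∀ e a b → + 2 * b + e ≡ + 2 * a + e + 1ℤ + 1ℤ + + 2 * (b - a - 1ℤ)
        lem = solve-∀
      σ≡id : ∀ x → fun σ x ≡ x
      σ≡id = increasing⇒id σ σ-increasing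

    -- `shortest` and `chains` range over all offsets, not only that of `perm`: an atom comes with
    -- its own Θ, and every atom must be compared with the same element.
    record Extremal (o : Side) : Set where
      field
        {offset} : ℤ
        offset∈ : Parity offset
        perm : AffPerm n
        pairs : Pairs z offset perm
        rising : Rising offset perm
        sorted : Sorted offset o perm
        shortest : ∀ e u → Pairs z e u → len perm ℕ.≤ len u
        chains : ∀ e u → Pairs z e u → Rising e u → (∀ u′ → Pairs z e u′ → len u ℕ.≤ len u′) → Chain o perm u

    extremal : ∀ o → Extremal o
    extremal o = record
      { offset∈ = proj₁ (proj₂ seed) ; perm = w ; pairs = pairs ; rising = rising ; sorted = sorted
      ; shortest = shortest ; chains = chains }
      where
      module Sort (e : ℤ) (u : AffPerm n) (pu : Pairs z e u) (ru : Rising e u) where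
        result : Σ (AffPerm n) λ v → Pairs z e v × Rising e v × Sorted e o v × len v ℕ.≤ len u × (len v ≡ len u → Chain o v u)
        result = sort o u pu ru
        v : AffPerm n
        v = proj₁ result
        pv : Pairs z e v
        pv = proj₁ (proj₂ result)
        rv : Rising e v
        rv = proj₁ (proj₂ (proj₂ result))
        sv : Sorted e o v
        sv = proj₁ (proj₂ (proj₂ (proj₂ result)))
        v≤u : len v ℕ.≤ len u
        v≤u = proj₁ (proj₂ (proj₂ (proj₂ (proj₂ result))))
        chain : len v ≡ len u → Chain o v u
        chain = proj₂ (proj₂ (proj₂ (proj₂ (proj₂ result))))
      module Raise (e : ℤ) (u : AffPerm n) (pu : Pairs z e u) where
        result : Σ (AffPerm n) λ v → Pairs z e v × Rising e v × len v ℕ.≤ len u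
        result = raise u pu
        v : AffPerm n
        v = proj₁ result
        pv : Pairs z e v
        pv = proj₁ (proj₂ result)
        rv : Rising e v
        rv = proj₁ (proj₂ (proj₂ result))
        v≤u : len v ℕ.≤ len u
        v≤u = proj₂ (proj₂ (proj₂ result))
      seed : Σ ℤ λ e → Parity e × Σ (AffPerm n) λ w → Pairs z e w
      seed = pairs-exist z fpf
      e : ℤ
      e = proj₁ seed
      module R = Raise e (proj₁ (proj₂ (proj₂ seed))) (proj₂ (proj₂ (proj₂ seed)))
      open Sort e R.v R.pv R.rv using () renaming (v to w; pv to pairs; rv to rising; sv to sorted)
      unique : ∀ e′ v → Pairs z e′ v → Rising e′ v → Sorted e′ o v → w ≈ v
      unique e′ v pv rv sv = sorted-unique o {e} {e′} {w} {v} pairs rising sorted pv rv sv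
      -- Raising and then sorting u never lengthens it, and by uniqueness the outcome is w.
      shortest : ∀ e′ u → Pairs z e′ u → len w ℕ.≤ len u
      shortest e′ u pu = ℕ.≤-trans (ℕ.≤-reflexive (len-cong {w} {S.v} (≈⇒inv {w} {S.v} (unique e′ S.v S.pv S.rv S.sv))))
        (ℕ.≤-trans S.v≤u T.v≤u)
        where
        module T = Raise e′ u pu
        module S = Sort e′ T.v T.pv T.rv
      chains : ∀ e′ u → Pairs z e′ u → Rising e′ u → (∀ u′ → Pairs z e′ u′ → len u ℕ.≤ len u′) → Chain o w u
      chains e′ u pu ru min = chain-resp o {w} {S.v} {u} (unique e′ S.v S.pv S.rv S.sv)
        (S.chain (ℕ.≤-antisym S.v≤u (min S.v S.pv)))
        where module S = Sort e′ u pu ru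

    atom⇒ : ∀ {w} → InAtoms z w → Σ ℤ λ e → Pairs z e w × Rising e w × (∀ u → Pairs z e u → len w ℕ.≤ len u)
    atom⇒ {w} (Θ , Θ∈ , conj , k , isLength , min) = e , pairs , rising , shortest
      where
      pairing : Θ ≡ Θ⁺ n ⊎ Θ ≡ Θ⁻ n → Σ ℤ λ e → IsPairing e Θ
      pairing (inj₁ refl) = - 1ℤ , Θ⁺-pairing
      pairing (inj₂ refl) = 0ℤ , Θ⁻-pairing
      e = proj₁ (pairing Θ∈)
      pairs : Pairs z e w
      pairs = conj⇒pairs {z} {w} {Θ = Θ} (proj₂ (pairing Θ∈)) conj
      shortest : ∀ u → Pairs z e u → len w ℕ.≤ len u
      shortest u pu = subst (ℕ._≤ len u) (IsLength-unique {w} isLength)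
        (min u (pairs⇒conj {z} {u} {Θ = Θ} fpf (proj₂ (pairing Θ∈)) pu) (len u) (len-IsLength u))
      -- A falling pair could be turned around, giving a shorter element for the same Θ.
      rising : Rising e w
      rising j with <-or-≥ (inv w (left e j)) (inv w (left e j + 1ℤ))
      ... | inj₁ lt = lt
      ... | inj₂ ge = contradiction (shortest (swap (left e j) w) (swap-pairs e w j pairs))
        (ℕ.<⇒≱ (ℕ.≤-reflexive (sym (len-descent w (left e j) (ℤ.≤∧≢⇒< ge λ eq → i≢i+1 (left e j) (sym (inv-injective w eq)))))))

    ⇒atom : ∀ {w} e → Parity e → Pairs z e w → (∀ u → Pairs z e u → len w ℕ.≤ len u) → InAtoms z w
    ⇒atom {w} e e∈ pairs min = Θ e∈ , Θ∈ e∈ , pairs⇒conj {z} {w} {Θ = Θ e∈} fpf (pairing e∈) pairs , len w , len-IsLength w ,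
      λ u conj k isLength → subst (len w ℕ.≤_) (sym (IsLength-unique {u} isLength)) (min u (conj⇒pairs {z} {u} {Θ = Θ e∈} (pairing e∈) conj))
      where
      Θ : Parity e → ℤ → ℤ
      Θ (inj₁ _) = Θ⁻ n
      Θ (inj₂ _) = Θ⁺ n
      Θ∈ : ∀ p → Θ p ≡ Θ⁺ n ⊎ Θ p ≡ Θ⁻ n
      Θ∈ (inj₁ _) = inj₂ refl
      Θ∈ (inj₂ _) = inj₁ refl
      pairing : ∀ p → IsPairing e (Θ p)
      pairing (inj₁ refl) = Θ⁻-pairing
      pairing (inj₂ refl) = Θ⁺-pairing

    -- If m + 1 were a right position, then m + 2 and m + 3 would form a pair carrying d and b,
    -- which falls.
    ≺₀-aligned : ∀ {e u v} → Rising e u → ((m , _) : u ≺₀ v) → ∃ λ j → m + 1ℤ ≡ left e j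
    ≺₀-aligned {e} {u} rising (m , a , b , c , d , _ , b<c , c<d , (_ , u₂ , u₃ , _) , _) with parity e (m + 1ℤ)
    ... | j , inj₁ eq = j , eq
    ... | j , inj₂ eq = contradiction (ℤ.<-trans b<c c<d) (ℤ.<-asym (subst₂ _<_ (trans (cong (inv u) eq₂) u₂) (trans (cong (inv u) eq₃) u₃) (rising (j + 1ℤ))))
      where
      eq₂ : left e (j + 1ℤ) ≡ m + + 2
      eq₂ = trans (left-suc e j) (trans (sym (ℤ.+-assoc (left e j) 1ℤ 1ℤ)) (trans (cong (_+ 1ℤ) (sym eq)) (ℤ.+-assoc m 1ℤ 1ℤ)))
      eq₃ : left e (j + 1ℤ) + 1ℤ ≡ m + + 3
      eq₃ = trans (cong (_+ 1ℤ) eq₂) (ℤ.+-assoc m (+ 2) 1ℤ)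

    -- The smaller ends appear as a, b in u and as b, a in v, so the reverse step from v to u sorts
    -- them and lowers the disorder.
    ≺₀-increases : ∀ {e u v} → Rising e u → u ≺₀ v → Rising e v × disorder e lower u < disorder e lower v
    ≺₀-increases {e} {u} {v} rising u≺v@(m , a , b , c , d , a<b , b<c , c<d , (u₁ , u₂ , u₃ , u₄) , _) with ≺₀-aligned {e} {u} {v} rising u≺v
    ... | j , eq = Rising-preserved {e} {j} swapped rising ,
        -- That l ≥ 2 follows from the larger ends in u, where d precedes c.
        disorder-drop e lower {j} (descent⇒2≤l e upper u j (subst₂ _<_ (sym k₄) (sym k₂) c<d)) (PairSwapped-sym swapped)
          (subst₂ _<_ (trans (trans (sym u₁) (cong (inv u) eq)) (sym second)) (trans (trans (sym u₃) (cong (inv u) eq₃)) (sym first)) a<b)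
      where
      swapped : PairSwapped (left e j) u v
      swapped = subst (λ t → PairSwapped t u v) eq (≺₀⇒PairSwapped {u} {v} u≺v)
      open Transposed (PairSwapped-transposed e lower {j} swapped)
      eq₃ : m + + 3 ≡ left e (j + 1ℤ)
      eq₃ = trans (sym (ℤ.+-assoc m 1ℤ (+ 2))) (trans (cong (_+ + 2) eq) (sym (left-suc e j)))
      k₂ : key e upper u j ≡ d
      k₂ = trans (cong (inv u) (trans (cong (_+ 1ℤ) (sym eq)) (ℤ.+-assoc m 1ℤ 1ℤ))) u₂
      k₄ : key e upper u (j + 1ℤ) ≡ c
      k₄ = trans (cong (inv u) (trans (cong (_+ 1ℤ) (sym eq₃)) (ℤ.+-assoc m (+ 3) 1ℤ))) u₄

    ≺-increases : ∀ e {u v} → Rising e u → u ≺ v → disorder e lower u < disorder e lower v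
    ≺-increases e {u} rising ([_]⁺ {y = v} p) = proj₂ (≺₀-increases {e} {u} {v} rising p)
    ≺-increases e {u} {w} rising (_∷⁺_ {y = v} p ps) = ℤ.<-trans (proj₂ increase) (≺-increases e {v} {w} (proj₁ increase) ps)
      where
      increase : Rising e v × disorder e lower u < disorder e lower v
      increase = ≺₀-increases {e} {u} {v} rising p

    atoms-irreflexive : ∀ w → InAtoms z w → ¬ (w ≺ w)
    atoms-irreflexive w atom w≺w = ℤ.<-irrefl refl (≺-increases (proj₁ shape) {w} {w} (proj₁ (proj₂ (proj₂ shape))) w≺w)
      where shape = atom⇒ {w} atom

-- Windows of the extremal elements

filter-rng : ∀ {P : ℤ → Set} (P? : ∀ x → Dec (P x)) f → (∀ j → f j < f (j + 1ℤ)) → (∀ j → P (f j)) → (∀ x → P x → ∃ λ j → x ≡ f j) →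
  ∀ k x j → f j < x → x ≤ f (j + 1ℤ) →
  ∃ λ m → filter P? (rng x k) ≡ map f (rng (j + 1ℤ) m) × f (j + + m) < x + + k × x + + k ≤ f (j + + m + 1ℤ)
filter-rng P? f f< sound complete zero x j below above = 0 , refl ,
  subst₂ _<_ (cong f (sym (ℤ.+-identityʳ j))) (sym (ℤ.+-identityʳ x)) below ,
  subst₂ _≤_ (sym (ℤ.+-identityʳ x)) (cong (λ y → f (y + 1ℤ)) (sym (ℤ.+-identityʳ j))) above
filter-rng P? f f< sound complete (suc k) x j below above with P? x
-- The invariant places x after f j and no later than f (j + 1), so a hit can only be f (j + 1). The
-- bracket around the end x + k is kept because it later determines the number m of hits.
... | yes p with complete x p
...   | i , refl
      with filter-rng P? f f< sound complete k (f i + 1ℤ) (j + 1ℤ) (≤⇒<suc next≤) (<⇒suc≤ (subst (_< f (j + 1ℤ + 1ℤ)) next≡ (f< (j + 1ℤ))))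
  where
  next≤ : f (j + 1ℤ) ≤ f i
  next≤ = increasing-mono-≤ f f< (<⇒suc≤ (increasing-reflects f f< below))
  next≡ : f (j + 1ℤ) ≡ f i
  next≡ = ℤ.≤-antisym next≤ above
...     | m , eq , lt , le = suc m ,
  cong₂ _∷_ (ℤ.≤-antisym above (increasing-mono-≤ f f< (<⇒suc≤ (increasing-reflects f f< below)))) eq ,
  subst₂ _<_ (cong f (sym (+-suc-assoc j m))) (sym (+-suc-assoc (f i) k)) lt ,
  subst₂ _≤_ (sym (+-suc-assoc (f i) k)) (cong (λ y → f (y + 1ℤ)) (sym (+-suc-assoc j m))) le
filter-rng P? f f< sound complete (suc k) x j below above | no ¬p
  with filter-rng P? f f< sound complete k (x + 1ℤ) j (ℤ.<-trans below (≤⇒<suc ℤ.≤-refl))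
    (<⇒suc≤ (ℤ.≤∧≢⇒< above λ { refl → ¬p (sound (j + 1ℤ)) }))
... | m , eq , lt , le = m , eq , subst (f (j + + m) <_) (sym (+-suc-assoc x k)) lt ,
  subst (_≤ f (j + + m + 1ℤ)) (sym (+-suc-assoc x k)) le

-- An increasing integer function grows by at least one per step. It is thus at most 0 at -∣f 0∣ and
-- at least 1 after ∣f start∣ + 1 further steps, so the climb between them meets the crossing.
crossing : ∀ f → (∀ j → f j < f (j + 1ℤ)) → ∃ λ j → f j < 1ℤ × 1ℤ ≤ f (j + 1ℤ)
crossing f f< = climb (suc ∣ f start ∣) start start<1 end≥1
  where
  climb : ∀ t j → f j < 1ℤ → 1ℤ ≤ f (j + + t) → ∃ λ j → f j < 1ℤ × 1ℤ ≤ f (j + 1ℤ)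
  climb zero j lt le = contradiction lt (ℤ.≤⇒≯ (subst (1ℤ ≤_) (cong f (ℤ.+-identityʳ j)) le))
  climb (suc t) j lt le with <-or-≥ (f (j + 1ℤ)) 1ℤ
  ... | inj₂ ge = j , lt , ge
  ... | inj₁ lt′ = climb t (j + 1ℤ) lt′ (subst (1ℤ ≤_) (cong f (+-suc-assoc j t)) le)
  ≤∣∣ : ∀ x → x ≤ + ∣ x ∣
  ≤∣∣ (+ _) = ℤ.≤-refl
  ≤∣∣ -[1+ _ ] = -≤+
  -∣∣≤ : ∀ x → - (+ ∣ x ∣) ≤ x
  -∣∣≤ (+ zero) = ℤ.≤-refl
  -∣∣≤ (+ suc _) = -≤+
  -∣∣≤ -[1+ _ ] = ℤ.≤-refl
  start : ℤ
  start = - (+ ∣ f 0ℤ ∣)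
  start<1 : f start < 1ℤ
  start<1 = ≤⇒<suc (≤-from _ (+-nonneg (gap (subst (f start + + ∣ f 0ℤ ∣ ≤_) (cong f (ℤ.+-inverseˡ (+ ∣ f 0ℤ ∣)))
    (increasing-growth f f< start ∣ f 0ℤ ∣))) (gap (≤∣∣ (f 0ℤ)))) (lem (f start) (f 0ℤ) (+ ∣ f 0ℤ ∣)))
    where
    lem : ∀ a b c → 0ℤ ≡ a + (b - (a + c) + (c - b))
    lem = solve-∀
  end≥1 : 1ℤ ≤ f (start + + suc ∣ f start ∣)
  end≥1 = ℤ.≤-trans (≤-from _ (gap (-∣∣≤ (f start))) (trans (+-suc-assoc (f start) ∣ f start ∣) (lem (f start) (+ ∣ f start ∣))))
    (increasing-growth f f< start (suc ∣ f start ∣))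
    where
    lem : ∀ a c → a + 1ℤ + c ≡ 1ℤ + (a - (- c))
    lem = solve-∀

concatMap-map : ∀ (F G : ℤ → List ℤ) f → (∀ i → F (f i) ≡ G i) → ∀ xs → concatMap F (map f xs) ≡ concatMap G xs
concatMap-map F G f eq [] = refl
concatMap-map F G f eq (x ∷ xs) = cong₂ _++_ (eq x) (concatMap-map F G f eq xs)

map-rng-shift : ∀ (f : ℤ → ℤ) c x k → map (λ i → f (c + i)) (rng x k) ≡ map f (rng (c + x) k)
map-rng-shift f c x zero = refl
map-rng-shift f c x (suc k) = cong (f (c + x) ∷_)
  (trans (map-rng-shift f c (x + 1ℤ) k) (cong (λ y → map f (rng y k)) (sym (ℤ.+-assoc c x 1ℤ))))

map-rng-pairs : ∀ (f : ℤ → ℤ) e j k → map f (rng (left e j) (2 ℕ.* k)) ≡ concatMap (λ i → f (left e i) ∷ f (left e i + 1ℤ) ∷ []) (rng j k)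
map-rng-pairs f e j zero = refl
map-rng-pairs f e j (suc k) = trans (cong (λ k → map f (rng (left e j) k)) (ℕ.*-suc 2 k))
  (cong (λ xs → f (left e j) ∷ f (left e j + 1ℤ) ∷ xs)
    (trans (cong (λ y → map f (rng y (2 ℕ.* k))) (trans (ℤ.+-assoc (left e j) 1ℤ 1ℤ) (sym (left-suc e j)))) (map-rng-pairs f e (j + 1ℤ) k)))

module Windows (n : ℕ) (2≤n : 2 ℕ.≤ n) (l : ℕ) (n≡2l : n ≡ 2 ℕ.* l) (z : AffPerm n) (fpf : IsFPFInvolution z) where
  open Atoms n 2≤n l n≡2l
  open Involution z fpf

  entries : (AffPerm n) → ℤ → ℤ → List ℤ
  entries w e i = inv w (left e i) ∷ inv w (left e i + 1ℤ) ∷ []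

  -- A sorted key enumerates the relevant endpoints in increasing order, so those in 1, ..., n are l
  -- consecutive keys, and listing their pairs reads n consecutive values of the inverse. Both
  -- required windows are instances.
  sorted-window : ∀ {P : ℤ → Set} (P? : ∀ x → Dec (P x)) (F : ℤ → List ℤ) o e (w : AffPerm n) → Sorted e o w →
    (∀ j → P (key e o w j)) → (∀ x → P x → ∃ λ j → x ≡ key e o w j) → (∀ j → F (key e o w j) ≡ entries w e j) →
    HasWindow {n} (inv w) (concatMap F (filter P? (range1 n)))
  -- Key j + 1 is the first one that is at least 1; the subtracted 1 reflects that a window is read
  -- from m + 1 on.
  sorted-window P? F o e w sorted sound complete entry = left e (j + 1ℤ) - 1ℤ , trans window≡ (sym filter≡)
    where
    f = key e o w
    cross = crossing f sorted
    j = proj₁ cross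
    below = proj₁ (proj₂ cross)
    above = proj₂ (proj₂ cross)
    filtered = filter-rng P? f sorted sound complete n 1ℤ j below above
    m = proj₁ filtered
    lem : ∀ j k → j + k + 1ℤ ≡ j + 1ℤ + k
    lem = solve-∀
    suc-reflects : ∀ a b → j + + a < j + + b + 1ℤ → a ℕ.≤ b
    suc-reflects a b lt = drop‿+≤+ (≤-from _ (gap (<suc⇒≤ {y = j + + b} lt)) (lem′ j (+ a) (+ b)))
      where
      lem′ : ∀ j a b → b ≡ a + (j + b - (j + a))
      lem′ = solve-∀
    -- By periodicity f (j + l) < 1 + n ≤ f (j + l + 1), the same bracket that `filter-rng` gives
    -- for m.
    m≡l : m ≡ l
    m≡l = ℕ.≤-antisym
      (suc-reflects m l (increasing-reflects f sorted (ℤ.<-≤-trans (proj₁ (proj₂ (proj₂ filtered)))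
        (subst (1ℤ + N ≤_) (sym (trans (cong f (lem j (+ l))) (key-periodic e o w (j + 1ℤ)))) (ℤ.+-monoˡ-≤ N above)))))
      (suc-reflects l m (increasing-reflects f sorted (ℤ.<-≤-trans
        (subst (_< 1ℤ + N) (sym (key-periodic e o w j)) (ℤ.+-monoˡ-< N below)) (proj₂ (proj₂ (proj₂ filtered))))))
    filter≡ : concatMap F (filter P? (range1 n)) ≡ concatMap (entries w e) (rng (j + 1ℤ) l)
    filter≡ = trans (cong (λ xs → concatMap F (filter P? xs)) (range1≡rng n))
      (trans (cong (concatMap F) (proj₁ (proj₂ filtered)))
      (trans (concatMap-map F (entries w e) f entry (rng (j + 1ℤ) m)) (cong (λ k → concatMap (entries w e) (rng (j + 1ℤ) k)) m≡l)))
    lem₁ : ∀ x → x - 1ℤ + 1ℤ ≡ x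
    lem₁ = solve-∀
    window≡ : window (inv w) (left e (j + 1ℤ) - 1ℤ) n ≡ concatMap (entries w e) (rng (j + 1ℤ) l)
    window≡ = trans (cong (map (λ i → inv w (left e (j + 1ℤ) - 1ℤ + i))) (range1≡rng n))
      (trans (map-rng-shift (inv w) (left e (j + 1ℤ) - 1ℤ) 1ℤ n)
      (trans (cong₂ (λ y k → map (inv w) (rng y k)) (lem₁ (left e (j + 1ℤ))) n≡2l) (map-rng-pairs (inv w) e (j + 1ℤ) l)))

  extremal-atom : ∀ {o} (x : Extremal o) → InAtoms z (Extremal.perm x)
  extremal-atom x = ⇒atom {perm} offset offset∈ pairs (λ u pu → shortest offset u pu)
    where open Extremal x

  extremal-chain : ∀ {o} (x : Extremal o) w → InAtoms z w → Chain o (Extremal.perm x) w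
  extremal-chain x w atom = Extremal.chains x (proj₁ shape) w (proj₁ (proj₂ shape)) (proj₁ (proj₂ (proj₂ shape))) (proj₂ (proj₂ (proj₂ shape)))
    where shape = atom⇒ {w} atom

  lower-window : (x : Extremal lower) → IsAlphaMin z (Extremal.perm x)
  lower-window x = sorted-window (λ a → a <? fun z a) (λ a → a ∷ fun z a ∷ []) lower offset perm sorted
    (left<partner offset perm pairs rising)
    (λ a lt → proj₁ (endpoint a lt) , trans (sym (inv-fun perm a)) (cong (inv perm) (proj₂ (endpoint a lt))))
    (λ j → cong (λ y → inv perm (left offset j) ∷ y ∷ []) (pairs j))
    where
    open Extremal x
    endpoint = left-endpoint offset perm pairs rising

  upper-window : (x : Extremal upper) → IsAlphaMax z (Extremal.perm x)
  upper-window x = sorted-window (λ d → fun z d <? d) (λ d → fun z d ∷ d ∷ []) upper offset perm sorted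
    (λ j → subst (_< inv perm (left offset j + 1ℤ)) (sym (partner offset perm pairs rising j)) (rising j))
    (λ d lt → proj₁ (endpoint d lt) , trans (sym (inv-fun perm d)) (cong (inv perm) (proj₂ (endpoint d lt))))
    (λ j → cong (λ y → y ∷ inv perm (left offset j + 1ℤ) ∷ []) (partner offset perm pairs rising j))
    where
    open Extremal x
    endpoint = right-endpoint offset perm pairs rising

theorem3p9 : (n : ℕ) → 2 ℕ.≤ n → Σ ℕ (λ k → n ≡ 2 ℕ.* k) →
    (z : AffPerm n) → IsFPFInvolution z →
    (∀ (w : AffPerm n) → InAtoms z w → ¬ (w ≺ w)) ×
    Σ (AffPerm n) (λ wmin → IsAlphaMin z wmin × InAtoms z wmin ×
    (∀ (w : AffPerm n) → InAtoms z w → wmin ≈ w ⊎ wmin ≺ w)) ×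
    Σ (AffPerm n) (λ wmax → IsAlphaMax z wmax × InAtoms z wmax ×
    (∀ (w : AffPerm n) → InAtoms z w → wmax ≈ w ⊎ w ≺ wmax))
theorem3p9 n 2≤n (l , n≡2l) z fpf = atoms-irreflexive ,
  (Extremal.perm minimal , lower-window minimal , extremal-atom minimal , extremal-chain minimal) ,
  (Extremal.perm maximal , upper-window maximal , extremal-atom maximal , extremal-chain maximal)
  where
  open Atoms n 2≤n l n≡2l
  open Involution z fpf
  open Windows n 2≤n l n≡2l z fpf
  minimal : Extremal lower
  minimal = extremal lower
  maximal : Extremal upper
  maximal = extremal upper
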